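{- Let $I$ be a nonempty finite set, and let $I$ also denote the partition of $I$ into singletons. Consider the linear functors $\pi_I^\vee:\mathsf{Lay}_I^{\mathrm{op}}\to\mathsf{Ass}^\vee_I$ and $\mathcal A_I:\mathsf{Lay}_I\to\mathsf{Lay}_I$, and the contravariant functor $\mathrm{Hom}(-,I)$ on $\mathsf{Ass}_I^\vee$ represented by the zero-dimensional flat $T^\vee[I\text{ into singletons}]=0$ (the action on faces). Identify $\mathrm{Hom}_{\mathsf{Ass}_I^\vee}(T^\vee[P],0)$ with $\mathsf L^\vee[P]$ for each partition $P$ of $I$. For any adjoint face $X$ with semisimple support $T^\vee[Q]$ and any cut $\mathcal V:P\leftarrow Q$, $$X^{\mathcal V}=X\circ\pi_I^\vee(\mathcal V)$$ (composition in $\mathsf{Ass}^\vee_I$). Consequently, for every layered forest $\mathcal F:P\leftarrow Q$, the composite functor $\mathsf{Lay}_I\to\mathsf{Vec}$ obtained from $\pi_I^\vee$ followed by $\mathrm{Hom}(-,I)$ sends $\mathcal F$ to the linear map $\mathsf L^\vee[Q]\to\mathsf L^\vee[P]$, $X\mapsto X^{\mathcal F}$, and the composite functor obtained from $\pi_I^\vee\circ\mathcal A_I$ followed by $\mathrm{Hom}(-,I)$ sends $\mathcal F$ to the dual forest derivative $\boldsymbol\partial_{\mathcal F}^*:\mathsf L^\vee[Q]\to\mathsf L^\vee[P]$.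
   Context: **Arrangement and faces.** $\Bbbk$ is a field of characteristic zero. A partition $P=(S_1|\dots|S_k)$ of $I$ is an unordered set of disjoint nonempty blocks with union $I$; $Q$ is finer than $P$ if every block of $Q$ is contained in a block of $P$ ($Q=P$ allowed). $(I)$ is the one-block partition. Put $T^\vee[P]=\{h\in\mathbb R I:\sum_{i\in S_j}h_i=0 \text{ for all } j\}$ (the "semisimple" flats) and $T^\vee[(I)]$ is the ambient space of the adjoint braid arrangement $\mathrm{Br}^\vee[I]$, whose hyperplanes are $\{\sum_{i\in S}h_i=0\}$, $\emptyset\ne S\subsetneq I$. An adjoint face $X$ is (the characteristic function of) a relatively open face of this arrangement; it is determined by its sign function $s_X$, where $s_X(S)\in\{+,-,0\}$ is the sign of $\sum_{i\in S}h_i$ for $h$ in the face. Its support is its linear span. $\mathsf L^\vee[P]$ is the $\Bbbk$-vector space with basis the adjoint faces with support $T^\vee[P]$. **Forests and the category $\mathsf{Lay}_I$.** A layered forest $\mathcal F:P\leftarrow Q$ is a family of planar full binary trees, one over each block $S_j$ of $P$ with leaves labelled bijectively by the blocks of $Q$ contained in $S_j$, with a linear order on all the (internal) nodes in which each node precedes its descendants. $\mathsf{Lay}_I$ is the $\Bbbk$-linear category with objects the partitions of $I$, $\mathrm{Hom}(Q,P)$ the space of formal linear combinations of layered forests $P\leftarrow Q$, and composition $\mathcal F_1\circ\mathcal F_2:P\leftarrow R$ of $\mathcal F_1:P\leftarrow Q$, $\mathcal F_2:Q\leftarrow R$ given by grafting the trees of $\mathcal F_2$ onto the leaves of $\mathcal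 F_1$, with all nodes of $\mathcal F_1$ preceding those of $\mathcal F_2$. A cut $\mathcal V=[C,D]:P\leftarrow Q$ is a forest with exactly one node, splitting a block $C\sqcup D$ of $P$ into left part $C$ and right part $D$; $\overline{\mathcal V}=[D,C]$. $\mathsf{Lay}_I$ is freely generated by cuts: every layered forest is uniquely $\mathcal F=\mathcal V_1\circ\dots\circ\mathcal V_l$. $\mathcal A_I(\mathcal F)$ is the alternating sum of all layered forests obtained from $\mathcal F$ by switching left and right branches at nodes, with sign the parity of the number of switches. **Derivatives.** For $E\subseteq I$, $\mathrm{Redn}_P(E)$ is $E$ with all blocks of $P$ contained in $E$ removed; $E=S\bmod P$ means $\mathrm{Redn}_P(E)=\mathrm{Redn}_P(S)$. For an adjoint face $X\in\mathsf L^\vee[Q]$ and a cut $\mathcal V=[C,D]:P\leftarrow Q$, $X^{\mathcal V}\in\mathsf L^\vee[P]$ is the adjoint face with sign at $S$ equal to $+$ if $S=C\bmod P$, $-$ if $S=D\bmod P$, $s_X(S)$ if $S\ne\emptyset\bmod Q$, $0$ if $S=\emptyset\bmod P$. For $\mathcal F=\mathcal V_1\circ\dots\circ\mathcal V_l$, $X^{\mathcal F}=((X^{\mathcal V_l})^{\dots})^{\mathcal V_1}$. The dual derivative is $\boldsymbol\partial^*_{\mathcal V}X=X^{\mathcal V}-X^{\overline{\mathcal V}}$, extended linearly, and $\boldsymbol\partial^*_{\mathcal F}=\boldsymbol\partial^*_{\mathcal V_1}\circ\dots\circ\boldsymbol\partial^*_{\mathcal V_l}$. **Category of lunes.** $\mathsf{Ass}_I^\vee$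 is the $\Bbbk$-linearization of the category of lunes of $\mathrm{Br}^\vee[I]$: objects are the flats (intersections of hyperplanes); for flats $B\subseteq A$, a lune with source (case) $A$ and target (base) $B$ is a closed chamber of the arrangement in $A$ formed by the hyperplanes $H\cap A$ of $A$, where $H$ is a hyperplane of $\mathrm{Br}^\vee[I]$ containing $B$ but not $A$. For lunes $M:A\to B$ and $L:B\to C$, $L\circ M:A\to C$ is the unique lune $N$ with case $A$ and base $C$ such that $L\subseteq N\subseteq M$. Lunes with case $T^\vee[P]$ and base $0$ are the closures of the faces with support $T^\vee[P]$; this gives the identification of $\mathrm{Hom}_{\mathsf{Ass}_I^\vee}(T^\vee[P],0)$ with $\mathsf L^\vee[P]$. The functor $\pi_I^\vee$ sends $P$ to $T^\vee[P]$ and a cut $\mathcal V=[C,D]:P\leftarrow Q$ to the closed half-space $\{h\in T^\vee[P]:\sum_{i\in C}h_i\ge0\}$, a lune with case $T^\vee[P]$ and base $T^\vee[Q]$. -}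

module Defs where

open import Algebra.Bundles using (CommutativeRing)
import Algebra.Definitions.RawMonoid
import Algebra.Properties.Ring as RingProperties
import Algebra.Properties.Semiring.Exp as Exp
import Algebra.Properties.Semiring.Sum as Sum
open import Data.Bool.Base using (Bool; true; false; T; not; _∧_; if_then_else_)
import Data.Bool.Properties as Bool
open import Data.Empty using (⊥-elim)
open import Data.Fin.Base using (Fin; zero; suc)
open import Data.Fin.Properties using (any?)
open import Data.Fin.Subset using (Subset; _∈_; _∉_; _⊆_; _∩_; _∪_; ∁; Nonempty; Empty; ⁅_⁆; ⊤; ⊥; inside; outside; ∣_∣)
open import Data.Fin.Subset.Properties using (_∈?_; _⊆?_; ∉⊥; ∈⊤; x∈⁅x⁆; x∈⁅y⁆⇒x≡y; x∈p∪q⁻; x∈p∪q⁺; x∈p∩q⁺; x∈p∩q⁻; p⊆p∪q; q⊆p∪q; x∈∁p⇒x∉p; x∉p⇒x∈∁p; nonempty?; Empty-unique; ⊆-antisym; ∪-comm; ∩-comm)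
open import Data.List.Base as List using (List; []; _∷_; _++_; allFin)
open import Data.List.Membership.Propositional using () renaming (_∈_ to _∈ˡ_)
open import Data.List.Membership.Propositional.Properties using (∈-++⁻; ∈-++⁺ˡ; ∈-++⁺ʳ; ∈-map⁻; ∈-map⁺; ∈-allFin)
open import Data.List.Properties using (map-++)
open import Data.List.Relation.Binary.Permutation.Propositional using (_↭_; ↭-refl; ↭-sym; ↭-trans; ↭-prep; ↭⇒↭ₛ)
open import Data.List.Relation.Binary.Permutation.Propositional.Properties using (All-resp-↭; ∈-resp-↭; ++⁺; ++-comm)
import Data.List.Relation.Binary.Permutation.Setoid.Properties as PermutationSetoid
open import Data.List.Relation.Unary.All as All using (All; []; _∷_)
import Data.List.Relation.Unary.All.Properties as All
open import Data.List.Relation.Unary.AllPairs using ([]; _∷_)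
open import Data.List.Relation.Unary.Any using (here; there)
open import Data.List.Relation.Unary.Unique.Propositional using (Unique)
import Data.List.Relation.Unary.Unique.Propositional.Properties as Unique
open import Data.Nat.Base as Nat using (ℕ; zero; suc; pred; NonZero; s≤s; z≤n)
import Data.Nat.Properties as ℕ
open import Data.Product.Base using (∃; ∃-syntax; Σ; Σ-syntax; _×_; _,_; proj₁; proj₂)
open import Data.Sum.Base using (_⊎_; inj₁; inj₂; [_,_]′)
open import Data.Vec.Base as Vec using ([]; _∷_; lookup; tabulate)
open import Data.Vec.Functional using (Vector)
open import Data.Vec.Properties using (≡-dec; []=⇒lookup; lookup⇒[]=; lookup∘tabulate; lookup-replicate)
open import Function.Base using (_∘_; id)
open import Function.Bundles using (Inverse)
open import Level using (Level; _⊔_; 0ℓ) renaming (suc to lsuc)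
open import Relation.Binary.Bundles using (Setoid)
open import Relation.Binary.Core using (Rel)
open import Relation.Binary.Definitions using (DecidableEquality; tri<; tri≈; tri>)
open import Relation.Binary.PropositionalEquality as ≡ using (_≡_; _≢_)
import Relation.Binary.Reasoning.Setoid as SetoidReasoning
open import Relation.Binary.Structures using (IsStrictTotalOrder)
open import Relation.Nullary using (¬_; contradiction; Dec; yes; no; recompute)
open import Relation.Nullary.Decidable using (⌊_⌋; toWitness; fromWitness; isYes≗does; dec-false; decidable-stable; T?)
open import Relation.Unary using (Pred; _≐_) renaming (_⊆_ to _⊑_)
open import Relation.Unary.Properties using (≐-refl; ≐-sym; ≐-trans)

record Field c ℓ : Set (lsuc (c ⊔ ℓ)) where
  field
    commutativeRing : CommutativeRing c ℓ
  open CommutativeRing commutativeRing public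
  field
    1≉0     : ¬ (1# ≈ 0#)
    inverse : ∀ x → ¬ (x ≈ 0#) → ∃[ y ] x * y ≈ 1#

CharacteristicZero : ∀ {c ℓ} → Field c ℓ → Set ℓ
CharacteristicZero 𝕜 = ∀ m → m ×₁ 1# ≈ 0# → m ≡ 0
  where
  open Field 𝕜
  open import Algebra.Definitions.RawMonoid +-rawMonoid using () renaming (_×_ to _×₁_)

-- The scalars of the arrangement.  The standard library has no real numbers;
-- of ℝ only the structure of a (strictly, totally) ordered field is used, so the
-- arrangement is set up in (a power of) an arbitrary such field.
record OrderedField ℓ : Set (lsuc ℓ) where
  field
    underlying : Field ℓ ℓ
  open Field underlying public
  field
    _<_                : Rel Carrier ℓ
    isStrictTotalOrder : IsStrictTotalOrder _≈_ _<_
    +-monoʳ-<          : ∀ z {x y} → x < y → (z + x) < (z + y)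
    *-positive         : ∀ {x y} → 0# < x → 0# < y → 0# < (x * y)
  infix 4 _<_ _≤_
  _≤_ : Rel Carrier ℓ
  x ≤ y = ¬ (y < x)
  open IsStrictTotalOrder isStrictTotalOrder public
    using (compare; _≟_; <-resp-≈; asym) renaming (trans to <-trans; irrefl to <-irrefl; <-respˡ-≈ to <-respˡ; <-respʳ-≈ to <-respʳ)

data Sgn : Set where
  pos neg zer : Sgn

_·_ : Sgn → Sgn → Sgn
pos · s = s
zer · s = zer
neg · pos = neg
neg · zer = zer
neg · neg = pos

module Signs {ℓ} (R : OrderedField ℓ) where
  open OrderedField R
  open RingProperties ring
  open SetoidReasoning setoid

  sgn : Carrier → Sgn
  sgn x with compare 0# x
  ... | tri< _ _ _ = pos
  ... | tri≈ _ _ _ = zer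
  ... | tri> _ _ _ = neg

  sgn-pos : ∀ {x} → 0# < x → sgn x ≡ pos
  sgn-pos {x} p with compare 0# x
  ... | tri< _ _ _ = ≡.refl
  ... | tri≈ n _ _ = contradiction p n
  ... | tri> n _ _ = contradiction p n

  sgn-neg : ∀ {x} → x < 0# → sgn x ≡ neg
  sgn-neg {x} p with compare 0# x
  ... | tri< _ _ n = contradiction p n
  ... | tri≈ _ _ n = contradiction p n
  ... | tri> _ _ _ = ≡.refl

  sgn-zer : ∀ {x} → x ≈ 0# → sgn x ≡ zer
  sgn-zer {x} p with compare 0# x
  ... | tri< _ n _ = contradiction (sym p) n
  ... | tri≈ _ _ _ = ≡.refl
  ... | tri> _ n _ = contradiction (sym p) n

  pos-sgn : ∀ {x} → sgn x ≡ pos → 0# < x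
  pos-sgn {x} e with compare 0# x
  ... | tri< p _ _ = p
  pos-sgn {x} () | tri≈ _ _ _
  pos-sgn {x} () | tri> _ _ _

  neg-sgn : ∀ {x} → sgn x ≡ neg → x < 0#
  neg-sgn {x} e with compare 0# x
  ... | tri> _ _ p = p
  neg-sgn {x} () | tri≈ _ _ _
  neg-sgn {x} () | tri< _ _ _

  zer-sgn : ∀ {x} → sgn x ≡ zer → x ≈ 0#
  zer-sgn {x} e with compare 0# x
  ... | tri≈ _ p _ = sym p
  zer-sgn {x} () | tri> _ _ _
  zer-sgn {x} () | tri< _ _ _

  sgn-cong : ∀ {x y} → x ≈ y → sgn x ≡ sgn y
  sgn-cong {x} {y} e with compare 0# y
  ... | tri< p _ _ = sgn-pos (<-respʳ (sym e) p)
  ... | tri≈ _ p _ = sgn-zer (trans e (sym p))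
  ... | tri> _ _ p = sgn-neg (<-respˡ (sym e) p)

  neg-pos : ∀ {x} → x < 0# → 0# < - x
  neg-pos {x} p = <-respʳ (+-identityʳ (- x)) (<-respˡ (-‿inverseˡ x) (+-monoʳ-< (- x) p))

  pos-neg : ∀ {x} → 0# < - x → x < 0#
  pos-neg {x} p = <-respʳ (-‿inverseʳ x) (<-respˡ (+-identityʳ x) (+-monoʳ-< x p))

  sgn-* : ∀ x y → sgn (x * y) ≡ sgn x · sgn y
  sgn-* x y with compare 0# x | compare 0# y
  ... | tri≈ _ p _ | _ = sgn-zer (trans (*-congʳ (sym p)) (zeroˡ y))
  ... | tri< p _ _ | tri< q _ _ = sgn-pos (*-positive p q)
  ... | tri< p _ _ | tri≈ _ q _ = sgn-zer (trans (*-congˡ (sym q)) (zeroʳ x))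
  ... | tri< p _ _ | tri> _ _ q = sgn-neg (pos-neg (<-respʳ (sym (-‿distribʳ-* x y)) (*-positive p (neg-pos q))))
  ... | tri> _ _ p | tri< q _ _ = sgn-neg (pos-neg (<-respʳ (sym (-‿distribˡ-* x y)) (*-positive (neg-pos p) q)))
  ... | tri> _ _ p | tri≈ _ q _ = sgn-zer (trans (*-congˡ (sym q)) (zeroʳ x))
  ... | tri> _ _ p | tri> _ _ q = sgn-pos (<-respʳ eq (*-positive (neg-pos p) (neg-pos q)))
    where
    eq : - x * - y ≈ x * y
    eq = begin
      - x * - y   ≈⟨ -‿distribˡ-* x (- y) ⟨
      - (x * - y) ≈⟨ -‿cong (-‿distribʳ-* x y) ⟨
      - - (x * y) ≈⟨ -‿involutive (x * y) ⟩
      x * y       ∎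

  sgn-1 : sgn 1# ≡ pos
  sgn-1 with sgn 1# in e | sgn-* 1# 1# | sgn-cong (*-identityˡ 1#)
  ... | pos | _ | _ = ≡.refl
  ... | zer | _ | _ = contradiction (zer-sgn e) 1≉0
  ... | neg | a | b with ≡.trans (≡.sym b) a
  ...   | ()

  sgn-neg-1 : sgn (- 1#) ≡ neg
  sgn-neg-1 = sgn-neg (pos-neg (<-respʳ (sym (-‿involutive 1#)) (pos-sgn sgn-1)))

  nonneg : ∀ {x} → 0# ≤ x → sgn x ≢ neg
  nonneg p e = p (neg-sgn e)

  nonneg′ : ∀ {x} → sgn x ≢ neg → 0# ≤ x
  nonneg′ p l = p (sgn-neg l)

  product : ∀ {x y} → 0# ≤ x * y → sgn x · sgn y ≢ neg
  product {x} {y} p e = nonneg p (≡.trans (sgn-* x y) e)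

  product′ : ∀ {x y} → sgn x · sgn y ≢ neg → 0# ≤ x * y
  product′ {x} {y} p = nonneg′ λ e → p (≡.trans (≡.sym (sgn-* x y)) e)

  same-side : ∀ {x y} → 0# ≤ x * y → ¬ x ≈ 0# → ¬ y ≈ 0# → sgn x ≡ sgn y
  same-side {x} {y} p x≉0 y≉0 with sgn x in ex | sgn y in ey | product {x} {y} p
  ... | pos | pos | _ = ≡.refl
  ... | neg | neg | _ = ≡.refl
  ... | pos | neg | n = contradiction ≡.refl n
  ... | neg | pos | n = contradiction ≡.refl n
  ... | zer | _   | _ = contradiction (zer-sgn ex) x≉0
  ... | pos | zer | _ = contradiction (zer-sgn ey) y≉0
  ... | neg | zer | _ = contradiction (zer-sgn ey) y≉0

  side-cong : ∀ {x y x′ y′} → sgn x ≡ sgn x′ → sgn y ≡ sgn y′ → 0# ≤ x * y → 0# ≤ x′ * y′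
  side-cong {x} {y} {x′} {y′} e e′ p = product′ λ q → product {x} {y} p (≡.trans (≡.cong₂ _·_ e e′) q)

  square : ∀ x → 0# ≤ x * x
  square x = product′ (sq (sgn x))
    where
    sq : ∀ s → s · s ≢ neg
    sq pos ()
    sq neg ()
    sq zer ()

  zero-side : ∀ {x y} → x ≈ 0# → 0# ≤ x * y
  zero-side {x} {y} e l = <-irrefl refl (<-respˡ (trans (*-congʳ e) (zeroˡ y)) l)

  -- If a ≉ 0, then K a + b has the sign of a for all large K.
  maximum : ∀ x y → ∃[ m ] (x ≤ m × y ≤ m)
  maximum x y with compare x y
  ... | tri< x<y _ _ = y , (λ y<x → asym x<y y<x) , λ y<y → <-irrefl refl y<y
  ... | tri≈ ¬x<y x≈y _ = y , (λ y<x → <-irrefl (sym x≈y) y<x) , λ y<y → <-irrefl refl y<y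
  ... | tri> _ _ y<x = x , (λ x<x → <-irrefl refl x<x) , λ x<y → asym x<y y<x

  ≤-<-trans : ∀ {x y z} → x ≤ y → y < z → x < z
  ≤-<-trans {x} {y} p q with compare x y
  ... | tri< l _ _ = <-trans l q
  ... | tri≈ _ e _ = <-respˡ (sym e) q
  ... | tri> _ _ l = contradiction l p

  ≤-trans : ∀ {x y z} → x ≤ y → y ≤ z → x ≤ z
  ≤-trans p q z<x = p (≤-<-trans q z<x)

  bound : ∀ {m} (f : Subset m → Carrier) → ∃[ k ] ∀ S → f S ≤ k
  bound {Nat.zero} f = f [] , λ { [] l → <-irrefl refl l }
  bound {Nat.suc m} f with bound (λ S → f (inside ∷ S)) | bound (λ S → f (outside ∷ S))
  ... | a , pa | b , pb with maximum a b
  ...   | k , pk , qk = k , λ { (true ∷ S) → ≤-trans (pa S) pk ; (false ∷ S) → ≤-trans (pb S) qk }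

  <-suc : ∀ x → x < x + 1#
  <-suc x = <-respˡ (+-identityʳ x) (+-monoʳ-< x (pos-sgn sgn-1))

  threshold : ∀ a b → ∃[ k ] ∀ K → k < K → ¬ a ≈ 0# → sgn (K * a + b) ≡ sgn a
  threshold a b with a ≟ 0#
  ... | yes a≈0 = 0# , λ K _ a≉0 → contradiction a≈0 a≉0
  ... | no a≉0 with inverse (a * a) q≉0
    where
    q≉0 : ¬ a * a ≈ 0#
    q≉0 e with sgn a in ea | ≡.trans (≡.sym (sgn-zer e)) (sgn-* a a)
    ... | zer | _ = a≉0 (zer-sgn ea)
  ...   | i , qi≈1 = k , λ K k<K _ → claim K k<K
    where
    q k : Carrier
    q = a * a
    k = - (b * a) * i

    q-sgn : sgn q ≡ pos
    q-sgn = ≡.trans (sgn-* a a) (sq (sgn a) λ e → a≉0 (zer-sgn e))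
      where
      sq : ∀ s → s ≢ zer → s · s ≡ pos
      sq pos _ = ≡.refl
      sq neg _ = ≡.refl
      sq zer n = contradiction ≡.refl n

    kq : k * q ≈ - (b * a)
    kq = begin
      - (b * a) * i * q   ≈⟨ *-assoc _ _ _ ⟩
      - (b * a) * (i * q) ≈⟨ *-congˡ (trans (*-comm i q) qi≈1) ⟩
      - (b * a) * 1#      ≈⟨ *-identityʳ _ ⟩
      - (b * a)           ∎

    claim : ∀ K → k < K → sgn (K * a + b) ≡ sgn a
    claim K k<K with sgn (K * a + b) | sgn a in ea | ≡.trans (≡.sym positive) (sgn-* (K * a + b) a)
      where
      K-k : 0# < K - k
      K-k = <-respʳ (+-comm (- k) K) (<-respˡ (-‿inverseˡ k) (+-monoʳ-< (- k) k<K))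
      expand : (K - k) * q ≈ (K * a + b) * a
      expand = begin
        (K - k) * q           ≈⟨ distribʳ q K (- k) ⟩
        K * q + - k * q       ≈⟨ +-cong (sym (*-assoc K a a)) (sym (-‿distribˡ-* k q)) ⟩
        K * a * a + - (k * q) ≈⟨ +-congˡ (trans (-‿cong kq) (-‿involutive _)) ⟩
        K * a * a + b * a     ≈⟨ distribʳ a (K * a) b ⟨
        (K * a + b) * a       ∎
      positive : sgn ((K * a + b) * a) ≡ pos
      positive = sgn-pos (<-respʳ expand (*-positive K-k (pos-sgn q-sgn)))
    ... | pos | pos | _ = ≡.refl
    ... | neg | neg | _ = ≡.refl
    ... | _ | zer | _ = contradiction (zer-sgn ea) a≉0

  perturb : ∀ {m} (a b : Subset m → Carrier) →
            ∃[ K ] ∀ S → ¬ a S ≈ 0# → sgn (K * a S + b S) ≡ sgn (a S)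
  perturb a b with bound (λ S → proj₁ (threshold (a S) (b S)))
  ... | k , k-max = k + 1# , λ S → proj₂ (threshold (a S) (b S)) (k + 1#) (≤-<-trans (k-max S) (<-suc k))

Unique-resp-↭ : ∀ {xs ys : List ℕ} → xs ↭ ys → Unique xs → Unique ys
Unique-resp-↭ p = PermutationSetoid.Unique-resp-↭ (≡.setoid ℕ) (↭⇒↭ₛ p)

module Partitions (n : ℕ) where
  open Nat using (_+_; _<_; _≤_)
  open ≡ using (refl; sym; trans; cong; cong₂; subst)

  infix 4 _≟ˢ_
  _≟ˢ_ : DecidableEquality (Subset n)
  _≟ˢ_ = ≡-dec Bool._≟_

  -- The finite set I is Fin n.
  record Partition : Set where
    field
      isBlock  : Subset n → Bool
      nonempty : ∀ {S} → T (isBlock S) → Nonempty S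
      disjoint : ∀ {S S′ i} → T (isBlock S) → T (isBlock S′) → i ∈ S → i ∈ S′ → S ≡ S′
      cover    : ∀ i → ∃[ S ] T (isBlock S) × i ∈ S

    blockOf : Fin n → Subset n
    blockOf i = proj₁ (cover i)

  open Partition public using (blockOf)

  -- S is a block of P
  infix 4 _∈ᵖ_
  _∈ᵖ_ : Subset n → Partition → Set
  S ∈ᵖ P = T (Partition.isBlock P S)

  _≐ᵖ_ : Partition → Partition → Set
  P ≐ᵖ Q = (∀ {S} → S ∈ᵖ P → S ∈ᵖ Q) × (∀ {S} → S ∈ᵖ Q → S ∈ᵖ P)

  oneBlock : .{{NonZero n}} → Partition
  oneBlock = record
    { isBlock  = λ S → ⌊ S ≟ˢ ⊤ ⌋
    ; nonempty = λ p → subst Nonempty (sym (toWitness p)) ⊤-nonempty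
    ; disjoint = λ p q _ _ → trans (toWitness p) (sym (toWitness q))
    ; cover    = λ _ → ⊤ , fromWitness refl , ∈⊤
    }
    where
    ⊤-nonempty : ∀ {m} .{{_ : NonZero m}} → Nonempty (⊤ {m})
    ⊤-nonempty {suc m} = zero , ∈⊤

  singletons : Partition
  singletons = record
    { isBlock  = λ S → ⌊ any? (λ i → S ≟ˢ ⁅ i ⁆) ⌋
    ; nonempty = λ p → let i , eq = toWitness p in i , subst (i ∈_) (sym eq) (x∈⁅x⁆ i)
    ; disjoint = λ p q → unique (toWitness p) (toWitness q)
    ; cover    = λ i → ⁅ i ⁆ , fromWitness (i , refl) , x∈⁅x⁆ i
    }
    where
    unique : ∀ {S S′ k} → ∃[ i ] S ≡ ⁅ i ⁆ → ∃[ j ] S′ ≡ ⁅ j ⁆ → k ∈ S → k ∈ S′ → S ≡ S′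
    unique (i , refl) (j , refl) k∈ k∈′ =
      cong ⁅_⁆ (trans (sym (x∈⁅y⁆⇒x≡y i k∈)) (x∈⁅y⁆⇒x≡y j k∈′))

  Redn : Partition → Subset n → Subset n
  Redn P E = tabulate λ i → lookup E i ∧ not ⌊ blockOf P i ⊆? E ⌋

  infix 4 _≡_mod_
  _≡_mod_ : Subset n → Subset n → Partition → Set
  S ≡ S′ mod P = Redn P S ≡ Redn P S′

  -- The cut [left, right] : P ← Q.  Since Q is a partition, the fields say that its
  -- blocks are those of P, except that left ⊔ right is replaced by left and right.
  record Cut (P Q : Partition) : Set where
    field
      left right : Subset n
      left-block  : left ∈ᵖ Q
      right-block : right ∈ᵖ Q
      left≢right  : left ≢ right
      whole-block : left ∪ right ∈ᵖ P
      other-block : ∀ {S} → S ∈ᵖ P → S ≢ left ∪ right → S ∈ᵖ Q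

  reverse : ∀ {P Q} → Cut P Q → Cut P Q
  reverse {P} V = record
    { left = right ; right = left
    ; left-block = right-block ; right-block = left-block
    ; left≢right = left≢right ∘ sym
    ; whole-block = subst (_∈ᵖ P) (∪-comm left right) whole-block
    ; other-block = λ p ne → other-block p (λ eq → ne (trans eq (∪-comm left right)))
    }
    where open Cut V

  record _splits-into_,_ (S C D : Subset n) : Set where
    constructor splits
    field
      union    : C ∪ D ≡ S
      disjoint : Empty (C ∩ D)

  -- Planar full binary trees over S, with numbered internal nodes and with leaves
  -- labelled by blocks of Q.  The leaves of a tree are disjoint with union S, hence
  -- they are the blocks of Q contained in S, each occurring once.
  data Tree (Q : Partition) : Subset n → Set where
    leaf : ∀ {S} → .(S ∈ᵖ Q) → Tree Q S
    node : ∀ {S C D} → ℕ → .(S splits-into C , D) → Tree Q C → Tree Q D → Tree Q S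

  labels : ∀ {Q S} → Tree Q S → List ℕ
  labels (leaf _)       = []
  labels (node k _ t u) = k ∷ labels t ++ labels u

  -- each node precedes its descendants
  data Increasing {Q} : ∀ {S} → Tree Q S → Set where
    leaf : ∀ {S} .{p : S ∈ᵖ Q} → Increasing (leaf p)
    node : ∀ {S C D k} .{p : S splits-into C , D} {t u} →
           All (k <_) (labels t) → All (k <_) (labels u) →
           Increasing t → Increasing u → Increasing (node k p t u)

  -- A linear order on the nodes is given as a numbering: by labelled, onto, unique and
  -- separated, every number below size is the label of exactly one node of the forest,
  -- and all labels are such numbers.
  record Forest (P Q : Partition) : Set where
    field
      size       : ℕ
      tree       : ∀ S → .(S ∈ᵖ P) → Tree Q S
      increasing : ∀ S (p : S ∈ᵖ P) → Increasing (tree S p)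
      labelled   : ∀ S (p : S ∈ᵖ P) → All (_< size) (labels (tree S p))
      onto       : ∀ {k} → k < size → ∃[ S ] Σ[ p ∈ S ∈ᵖ P ] k ∈ˡ labels (tree S p)
      unique     : ∀ S (p : S ∈ᵖ P) → Unique (labels (tree S p))
      separated  : ∀ {S S′ k} (p : S ∈ᵖ P) (p′ : S′ ∈ᵖ P) →
                   k ∈ˡ labels (tree S p) → k ∈ˡ labels (tree S′ p′) → S ≡ S′

  record _≈ᶠ_ {P Q : Partition} (F G : Forest P Q) : Set where
    open Forest
    field
      size-≡ : size F ≡ size G
      tree-≡ : ∀ S (p : S ∈ᵖ P) → tree F S p ≡ tree G S p

  relabel : ∀ {Q S} → (ℕ → ℕ) → Tree Q S → Tree Q S
  relabel f (leaf p)       = leaf p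
  relabel f (node k p t u) = node (f k) p (relabel f t) (relabel f u)

  graft : ∀ {R Q S} → Tree R S → (∀ E → .(E ∈ᵖ R) → Tree Q E) → Tree Q S
  graft (leaf p)       g = g _ p
  graft (node k p t u) g = node k p (graft t g) (graft u g)

  data Leaf {R} (E : Subset n) : ∀ {S} → Tree R S → Set where
    here : .{p : E ∈ᵖ R} → Leaf E (leaf p)
    inˡ : ∀ {S C D k} .{p : S splits-into C , D} {t u} → Leaf E t → Leaf E (node k p t u)
    inʳ : ∀ {S C D k} .{p : S splits-into C , D} {t u} → Leaf E u → Leaf E (node k p t u)

  splits? : ∀ S C D → Dec (S splits-into C , D)
  splits? S C D with (C ∪ D) ≟ˢ S | nonempty? (C ∩ D)
  ... | yes p | no  q = yes (splits p q)
  ... | no ¬p | _     = no λ where (splits p _) → ¬p p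
  ... | _     | yes q = no λ where (splits _ e) → e q

  T-recompute : ∀ {b} → .(T b) → T b
  T-recompute {b} = recompute (T? b)

  split-recompute : ∀ {S C D} → .(S splits-into C , D) → S splits-into C , D
  split-recompute {S} {C} {D} = recompute (splits? S C D)

  splitˡ : ∀ {S C D} → S splits-into C , D → C ⊆ S
  splitˡ (splits refl _) = p⊆p∪q _

  splitʳ : ∀ {S C D} → S splits-into C , D → D ⊆ S
  splitʳ (splits refl _) = q⊆p∪q _ _

  leaf-block : ∀ {R E S} {t : Tree R S} → Leaf E t → E ∈ᵖ R
  leaf-block (here {p}) = T-recompute p
  leaf-block (inˡ l)   = leaf-block l
  leaf-block (inʳ l)  = leaf-block l

  leaf-⊆ : ∀ {R E S} {t : Tree R S} → Leaf E t → E ⊆ S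
  leaf-⊆ here             x = x
  leaf-⊆ (inˡ {p = p} l) x = splitˡ (split-recompute p) (leaf-⊆ l x)
  leaf-⊆ (inʳ {p = p} l) x = splitʳ (split-recompute p) (leaf-⊆ l x)

  leaf-cover : ∀ {R S i} (t : Tree R S) → i ∈ S → ∃[ E ] Leaf E t × i ∈ E
  leaf-cover (leaf p) i∈ = _ , here , i∈
  leaf-cover (node k p t u) i∈ with split-recompute p
  ... | splits refl _ with x∈p∪q⁻ _ _ i∈
  ...   | inj₁ i∈C = let E , l , i∈E = leaf-cover t i∈C in E , inˡ l , i∈E
  ...   | inj₂ i∈D = let E , l , i∈E = leaf-cover u i∈D in E , inʳ l , i∈E

  leaf-apart : ∀ {R E S C D} {t : Tree R C} {u : Tree R D} → S splits-into C , D →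
               Leaf E t → ¬ Leaf E u
  leaf-apart {R} (splits _ e) l m =
    let i , i∈E = Partition.nonempty R (leaf-block l)
    in e (i , x∈p∩q⁺ (leaf-⊆ l i∈E , leaf-⊆ m i∈E))

  labels-relabel : ∀ {Q S} f (t : Tree Q S) → labels (relabel f t) ≡ List.map f (labels t)
  labels-relabel f (leaf p) = refl
  labels-relabel f (node k p t u) = cong (f k ∷_)
    (trans (cong₂ _++_ (labels-relabel f t) (labels-relabel f u)) (sym (map-++ f (labels t) (labels u))))

  ∈-relabel⁻ : ∀ {Q S k} f (t : Tree Q S) → k ∈ˡ labels (relabel f t) →
               ∃[ j ] j ∈ˡ labels t × k ≡ f j
  ∈-relabel⁻ f t k∈ = ∈-map⁻ f (subst (_ ∈ˡ_) (labels-relabel f t) k∈)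

  ∈-relabel⁺ : ∀ {Q S k} f (t : Tree Q S) → k ∈ˡ labels t → f k ∈ˡ labels (relabel f t)
  ∈-relabel⁺ f t k∈ = subst (_ ∈ˡ_) (sym (labels-relabel f t)) (∈-map⁺ f k∈)

  increasing-relabel : ∀ {Q S} (f : ℕ → ℕ) (M : ℕ → Set) →
    (∀ {i j} → M i → M j → i < j → f i < f j) →
    (t : Tree Q S) → All M (labels t) → Increasing t → Increasing (relabel f t)
  increasing-relabel f M mono (leaf p) _ leaf = leaf
  increasing-relabel f M mono (node k p t u) (mk ∷ ms) (node kt ku it iu) =
    node (below t (All.++⁻ˡ _ ms) kt) (below u (All.++⁻ʳ (labels t) ms) ku)
         (increasing-relabel f M mono t (All.++⁻ˡ _ ms) it)
         (increasing-relabel f M mono u (All.++⁻ʳ (labels t) ms) iu)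
    where
    below : ∀ {S} (v : Tree _ S) → All M (labels v) → All (k <_) (labels v) →
            All (f k <_) (labels (relabel f v))
    below v mv kv = subst (All (f k <_)) (sym (labels-relabel f v))
      (All.map⁺ (All.zipWith (λ (m , lt) → mono mk m lt) (mv , kv)))

  unique-++⁻ : ∀ (xs : List ℕ) {ys} → Unique (xs ++ ys) →
               Unique xs × Unique ys × (∀ {x} → x ∈ˡ xs → ¬ x ∈ˡ ys)
  unique-++⁻ [] uy = [] , uy , λ ()
  unique-++⁻ (x ∷ xs) (px ∷ uxy) with unique-++⁻ xs uxy
  ... | ux , uy , d = (All.++⁻ˡ xs px ∷ ux) , uy , λ where
    (here refl) y∈ → All.lookup (All.++⁻ʳ xs px) y∈ refl
    (there x∈)  y∈ → d x∈ y∈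

  module _ {R Q} (g : ∀ E → .(E ∈ᵖ R) → Tree Q E) where

    ∈-graft⁻ : ∀ {S k} (t : Tree R S) → k ∈ˡ labels (graft t g) →
      k ∈ˡ labels t ⊎ ∃[ E ] Σ[ p ∈ E ∈ᵖ R ] Leaf E t × k ∈ˡ labels (g E p)
    ∈-graft⁻ (leaf p) k∈ = inj₂ (_ , T-recompute p , here , k∈)
    ∈-graft⁻ (node j p t u) (here eq) = inj₁ (here eq)
    ∈-graft⁻ (node j p t u) (there k∈) with ∈-++⁻ (labels (graft t g)) k∈
    ... | inj₁ k∈t with ∈-graft⁻ t k∈t
    ...   | inj₁ x = inj₁ (there (∈-++⁺ˡ x))
    ...   | inj₂ (E , q , l , x) = inj₂ (E , q , inˡ l , x)
    ∈-graft⁻ (node j p t u) (there k∈) | inj₂ k∈u with ∈-graft⁻ u k∈u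
    ...   | inj₁ x = inj₁ (there (∈-++⁺ʳ (labels t) x))
    ...   | inj₂ (E , q , l , x) = inj₂ (E , q , inʳ l , x)

    ∈-graft⁺ˡ : ∀ {S k} (t : Tree R S) → k ∈ˡ labels t → k ∈ˡ labels (graft t g)
    ∈-graft⁺ˡ (node j p t u) (here eq) = here eq
    ∈-graft⁺ˡ (node j p t u) (there k∈) with ∈-++⁻ (labels t) k∈
    ... | inj₁ x = there (∈-++⁺ˡ (∈-graft⁺ˡ t x))
    ... | inj₂ x = there (∈-++⁺ʳ (labels (graft t g)) (∈-graft⁺ˡ u x))

    ∈-graft⁺ʳ : ∀ {S E k} {t : Tree R S} (p : E ∈ᵖ R) → Leaf E t → k ∈ˡ labels (g E p) →
                k ∈ˡ labels (graft t g)
    ∈-graft⁺ʳ q here      k∈ = k∈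
    ∈-graft⁺ʳ q (inˡ l)  k∈ = there (∈-++⁺ˡ (∈-graft⁺ʳ q l k∈))
    ∈-graft⁺ʳ q (inʳ {t = t} l) k∈ = there (∈-++⁺ʳ (labels (graft t g)) (∈-graft⁺ʳ q l k∈))

    module _ (b : ℕ) (above : ∀ E (p : E ∈ᵖ R) → All (b ≤_) (labels (g E p))) where

      above′ : ∀ {E k} (p : E ∈ᵖ R) → k ∈ˡ labels (g E p) → ¬ k < b
      above′ p k∈ k<b = ℕ.<⇒≱ k<b (All.lookup (above _ p) k∈)

      increasing-graft : (∀ E (p : E ∈ᵖ R) → Increasing (g E p)) →
        ∀ {S} (t : Tree R S) → All (_< b) (labels t) → Increasing t → Increasing (graft t g)
      increasing-graft ig (leaf p) _ leaf = ig _ (T-recompute p)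
      increasing-graft ig (node k p t u) (k<b ∷ bs) (node kt ku it iu) =
        node (below t kt) (below u ku)
             (increasing-graft ig t (All.++⁻ˡ _ bs) it)
             (increasing-graft ig u (All.++⁻ʳ (labels t) bs) iu)
        where
        below : ∀ {S} (v : Tree R S) → All (k <_) (labels v) → All (k <_) (labels (graft v g))
        below v kv = All.tabulate λ j∈ → [ All.lookup kv , (λ (E , q , _ , x) → ℕ.<-≤-trans k<b (All.lookup (above E q) x)) ]′ (∈-graft⁻ v j∈)

      unique-graft : (∀ E (p : E ∈ᵖ R) → Unique (labels (g E p))) →
        (∀ {E E′ k} (p : E ∈ᵖ R) (p′ : E′ ∈ᵖ R) → k ∈ˡ labels (g E p) → k ∈ˡ labels (g E′ p′) → E ≡ E′) →
        ∀ {S} (t : Tree R S) → All (_< b) (labels t) → Unique (labels t) → Unique (labels (graft t g))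
      unique-graft ug sep (leaf p) _ _ = ug _ (T-recompute p)
      unique-graft ug sep (node k p t u) (k<b ∷ bs) (k∉ ∷ us) =
        fresh ∷ Unique.++⁺ (unique-graft ug sep t bt (proj₁ utu))
                           (unique-graft ug sep u bu (proj₁ (proj₂ utu))) apart
        where
        bt = All.++⁻ˡ (labels t) bs
        bu = All.++⁻ʳ (labels t) bs
        utu = unique-++⁻ (labels t) us
        notIn : ∀ {S} (v : Tree R S) → ¬ k ∈ˡ labels v → ¬ k ∈ˡ labels (graft v g)
        notIn v k∉v k∈ = [ k∉v , (λ (E , q , _ , x) → above′ q x k<b) ]′ (∈-graft⁻ v k∈)
        fresh : All (k ≢_) (labels (graft t g) ++ labels (graft u g))
        fresh = All.tabulate λ where
          j∈ refl → [ notIn t (λ x → All.lookup k∉ (∈-++⁺ˡ x) refl)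
                    , notIn u (λ x → All.lookup k∉ (∈-++⁺ʳ (labels t) x) refl)
                    ]′ (∈-++⁻ (labels (graft t g)) j∈)
        apart : ∀ {j} → ¬ (j ∈ˡ labels (graft t g) × j ∈ˡ labels (graft u g))
        apart (x , y) with ∈-graft⁻ t x | ∈-graft⁻ u y
        ... | inj₁ a | inj₁ b = proj₂ (proj₂ utu) a b
        ... | inj₁ a | inj₂ (E , q , _ , z) = above′ q z (All.lookup bt a)
        ... | inj₂ (E , q , _ , z) | inj₁ a = above′ q z (All.lookup bu a)
        ... | inj₂ (E , q , l , z) | inj₂ (E′ , q′ , l′ , z′) with sep q q′ z z′
        ...   | refl = leaf-apart (split-recompute p) l l′

  idForest : ∀ {P Q} → P ≐ᵖ Q → Forest P Q
  idForest (P⊆Q , _) = record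
    { size = 0
    ; tree = λ S p → leaf (P⊆Q p)
    ; increasing = λ _ _ → leaf
    ; labelled = λ _ _ → []
    ; onto = λ ()
    ; unique = λ _ _ → []
    ; separated = λ _ _ ()
    }

  -- grafting: the nodes of F precede those of G
  infixr 9 _∘ᶠ_
  _∘ᶠ_ : ∀ {P R Q} → Forest P R → Forest R Q → Forest P Q
  _∘ᶠ_ {P} {R} {Q} F G = record
    { size = F.size + G.size
    ; tree = λ S p → graft (F.tree S p) shifted
    ; increasing = λ S p → increasing-graft shifted F.size above shifted-inc (F.tree S p) (F.labelled S p) (F.increasing S p)
    ; labelled = λ S p → All.tabulate (bound S p)
    ; onto = onto
    ; unique = λ S p → unique-graft shifted F.size above
        (λ E q → subst Unique (sym (labels-relabel _ (G.tree E q)))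
                   (Unique.map⁺ (ℕ.+-cancelˡ-≡ F.size _ _) (G.unique E q)))
        shifted-sep (F.tree S p) (F.labelled S p) (F.unique S p)
    ; separated = separated
    }
    where
    module F = Forest F
    module G = Forest G
    shifted : ∀ E → .(E ∈ᵖ R) → Tree Q E
    shifted E q = relabel (F.size +_) (G.tree E q)

    above : ∀ E (q : E ∈ᵖ R) → All (F.size ≤_) (labels (shifted E q))
    above E q = All.tabulate λ k∈ →
      let j , _ , eq = ∈-relabel⁻ _ (G.tree E q) k∈ in subst (F.size ≤_) (sym eq) (ℕ.m≤m+n F.size j)

    shifted-inc : ∀ E (q : E ∈ᵖ R) → Increasing (shifted E q)
    shifted-inc E q = increasing-relabel (F.size +_) (_< G.size) (λ _ _ → ℕ.+-monoʳ-< F.size)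
      (G.tree E q) (G.labelled E q) (G.increasing E q)

    shifted-sep : ∀ {E E′ k} (q : E ∈ᵖ R) (q′ : E′ ∈ᵖ R) →
      k ∈ˡ labels (shifted E q) → k ∈ˡ labels (shifted E′ q′) → E ≡ E′
    shifted-sep q q′ x y with ∈-relabel⁻ _ (G.tree _ q) x | ∈-relabel⁻ _ (G.tree _ q′) y
    ... | i , i∈ , eq | j , j∈ , eq′ with ℕ.+-cancelˡ-≡ F.size i j (trans (sym eq) eq′)
    ...   | refl = G.separated q q′ i∈ j∈

    bound : ∀ S (p : S ∈ᵖ P) {k} → k ∈ˡ labels (graft (F.tree S p) shifted) → k < F.size + G.size
    bound S p k∈ with ∈-graft⁻ shifted (F.tree S p) k∈
    ... | inj₁ x = ℕ.<-≤-trans (All.lookup (F.labelled S p) x) (ℕ.m≤m+n F.size G.size)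
    ... | inj₂ (E , q , _ , x) with ∈-relabel⁻ _ (G.tree E q) x
    ...   | j , j∈ , refl = ℕ.+-monoʳ-< F.size (All.lookup (G.labelled E q) j∈)

    onto : ∀ {k} → k < F.size + G.size →
           ∃[ S ] Σ[ p ∈ S ∈ᵖ P ] k ∈ˡ labels (graft (F.tree S p) shifted)
    onto {k} k< with k ℕ.<? F.size
    ... | yes k<F = let S , p , k∈ = F.onto k<F in S , p , ∈-graft⁺ˡ shifted (F.tree S p) k∈
    ... | no k≮F with ℕ.m≤n⇒∃[o]m+o≡n (ℕ.≮⇒≥ k≮F)
    ...   | j , refl with G.onto (ℕ.+-cancelˡ-< F.size j G.size k<)
    ...     | E , q , j∈ with Partition.nonempty R q
    ...       | i , i∈E with Partition.cover P i
    ...         | S , p , i∈S with leaf-cover (F.tree S p) i∈S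
    ...           | E′ , l , i∈E′ with Partition.disjoint R q (leaf-block l) i∈E i∈E′
    ...             | refl = S , p , ∈-graft⁺ʳ shifted q l (∈-relabel⁺ _ (G.tree E q) j∈)

    separated : ∀ {S S′ k} (p : S ∈ᵖ P) (p′ : S′ ∈ᵖ P) →
      k ∈ˡ labels (graft (F.tree S p) shifted) → k ∈ˡ labels (graft (F.tree S′ p′) shifted) → S ≡ S′
    separated {S} {S′} p p′ x y with ∈-graft⁻ shifted (F.tree _ p) x | ∈-graft⁻ shifted (F.tree _ p′) y
    ... | inj₁ a | inj₁ b = F.separated p p′ a b
    ... | inj₁ a | inj₂ (E , q , _ , z) = contradiction (All.lookup (F.labelled S p) a) (above′ {R} shifted F.size above q z)
    ... | inj₂ (E , q , _ , z) | inj₁ a = contradiction (All.lookup (F.labelled S′ p′) a) (above′ {R} shifted F.size above q z)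
    ... | inj₂ (E , q , l , z) | inj₂ (E′ , q′ , l′ , z′) with shifted-sep q q′ z z′
    ...   | refl = let i , i∈E = Partition.nonempty R q
                   in Partition.disjoint P p p′ (leaf-⊆ l i∈E) (leaf-⊆ l′ i∈E)

  ≐ᵖ-refl : ∀ {P} → P ≐ᵖ P
  ≐ᵖ-refl = id , id

  cut-splits : ∀ {P Q} (V : Cut P Q) → (Cut.left V ∪ Cut.right V) splits-into Cut.left V , Cut.right V
  cut-splits {Q = Q} V = splits refl λ (i , i∈) →
    let i∈C , i∈D = x∈p∩q⁻ left right i∈
    in left≢right (Partition.disjoint Q left-block right-block i∈C i∈D)
    where open Cut V

  module CutTree {P Q} (V : Cut P Q) where
    open Cut V

    cutTree : ∀ S → .(S ∈ᵖ P) → Dec (S ≡ left ∪ right) → Tree Q S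
    cutTree S p (yes eq) = node 0 (subst (_splits-into left , right) (sym eq) (cut-splits V))
                                  (leaf left-block) (leaf right-block)
    cutTree S p (no ne)  = leaf (other-block p ne)

  cut : ∀ {P Q} → Cut P Q → Forest P Q
  cut {P} {Q} V = record
    { size = 1
    ; tree = λ S p → cutTree S p (S ≟ˢ left ∪ right)
    ; increasing = λ S p → inc S p (S ≟ˢ left ∪ right)
    ; labelled = λ S p → lab S p (S ≟ˢ left ∪ right)
    ; onto = λ { {zero} _ → left ∪ right , whole-block , ont ((left ∪ right) ≟ˢ left ∪ right)
               ; {suc k} (s≤s ()) }
    ; unique = λ S p → unq S p (S ≟ˢ left ∪ right)
    ; separated = λ {S} {S′} p p′ → sep p p′ (S ≟ˢ left ∪ right) (S′ ≟ˢ left ∪ right)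
    }
    where
    open Cut V
    open CutTree V
    inc : ∀ S (p : S ∈ᵖ P) d → Increasing (cutTree S p d)
    inc S p (yes _) = node [] [] leaf leaf
    inc S p (no _)  = leaf
    lab : ∀ S (p : S ∈ᵖ P) d → All (_< 1) (labels (cutTree S p d))
    lab S p (yes _) = s≤s z≤n ∷ []
    lab S p (no _)  = []
    ont : ∀ d → 0 ∈ˡ labels (cutTree (left ∪ right) whole-block d)
    ont (yes _) = here refl
    ont (no ne) = contradiction refl ne
    unq : ∀ S (p : S ∈ᵖ P) d → Unique (labels (cutTree S p d))
    unq S p (yes _) = [] ∷ []
    unq S p (no _)  = []
    sep : ∀ {S S′ k} (p : S ∈ᵖ P) (p′ : S′ ∈ᵖ P) d d′ → k ∈ˡ labels (cutTree S p d) →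
          k ∈ˡ labels (cutTree S′ p′ d′) → S ≡ S′
    sep p p′ (yes refl) (yes refl) _ _ = refl
    sep p p′ (yes _) (no _) _ ()
    sep p p′ (no _) _ ()

  -- V₁ ∷ … ∷ V_l ∷ [] stands for V₁ ∘ … ∘ V_l.  As partitions are sets of blocks, the
  -- endpoints of the empty composite only need to have the same blocks.
  infixr 5 _∷_
  data Cuts : Partition → Partition → Set where
    []  : ∀ {P Q} → P ≐ᵖ Q → Cuts P Q
    _∷_ : ∀ {P R Q} → Cut P R → Cuts R Q → Cuts P Q

  composite : ∀ {P Q} → Cuts P Q → Forest P Q
  composite ([] P≐Q) = idForest P≐Q
  composite (V ∷ Vs) = cut V ∘ᶠ composite Vs

  module _ (P : Partition) {S C D : Subset n} (S∈P : S ∈ᵖ P) (split : S splits-into C , D)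
           (C≢∅ : Nonempty C) (D≢∅ : Nonempty D) where
    data Kind (E : Subset n) : Set where
      isLeft  : E ≡ C → Kind E
      isRight : E ≡ D → Kind E
      isOther : E ∈ᵖ P → E ≢ S → Kind E

    kind? : ∀ E → Dec (Kind E)
    kind? E with E ≟ˢ C | E ≟ˢ D | T? (Partition.isBlock P E) | E ≟ˢ S
    ... | yes p | _     | _     | _     = yes (isLeft p)
    ... | no _  | yes q | _     | _     = yes (isRight q)
    ... | no _  | no _  | yes r | no s  = yes (isOther r s)
    ... | no p  | no q  | no r  | _     = no λ where
      (isLeft x) → p x
      (isRight x) → q x
      (isOther x _) → r x
    ... | no p  | no q  | yes _ | yes s = no λ where
      (isLeft x) → p x
      (isRight x) → q x
      (isOther _ x) → x s

    private
      C⊆S : C ⊆ S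
      C⊆S = splitˡ split
      D⊆S : D ⊆ S
      D⊆S = splitʳ split

    splitBlock : Partition
    splitBlock = record
      { isBlock = λ E → ⌊ kind? E ⌋
      ; nonempty = λ p → ne (toWitness p)
      ; disjoint = λ p q → dj (toWitness p) (toWitness q)
      ; cover = cv
      }
      where
      ne : ∀ {E} → Kind E → Nonempty E
      ne (isLeft refl) = C≢∅
      ne (isRight refl) = D≢∅
      ne (isOther p _) = Partition.nonempty P p
      dj : ∀ {E E′ i} → Kind E → Kind E′ → i ∈ E → i ∈ E′ → E ≡ E′
      dj (isLeft refl) (isLeft refl) _ _ = refl
      dj (isLeft refl) (isRight refl) x y = contradiction (_ , x∈p∩q⁺ (x , y)) (_splits-into_,_.disjoint split)
      dj (isLeft refl) (isOther p q) x y = contradiction (Partition.disjoint P p S∈P y (C⊆S x)) q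
      dj (isRight refl) (isLeft refl) x y = contradiction (_ , x∈p∩q⁺ (y , x)) (_splits-into_,_.disjoint split)
      dj (isRight refl) (isRight refl) _ _ = refl
      dj (isRight refl) (isOther p q) x y = contradiction (Partition.disjoint P p S∈P y (D⊆S x)) q
      dj (isOther p q) (isLeft refl) x y = contradiction (Partition.disjoint P p S∈P x (C⊆S y)) q
      dj (isOther p q) (isRight refl) x y = contradiction (Partition.disjoint P p S∈P x (D⊆S y)) q
      dj (isOther p _) (isOther q _) x y = Partition.disjoint P p q x y
      cv : ∀ i → ∃[ E ] T ⌊ kind? E ⌋ × i ∈ E
      cv i with Partition.cover P i
      ... | E , p , i∈E with E ≟ˢ S
      ...   | no E≢S = E , fromWitness (isOther p E≢S) , i∈E
      ...   | yes refl with x∈p∪q⁻ C D (subst (i ∈_) (sym (_splits-into_,_.union split)) i∈E)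
      ...     | inj₁ i∈C = C , fromWitness (isLeft refl) , i∈C
      ...     | inj₂ i∈D = D , fromWitness (isRight refl) , i∈D

    C≢D : C ≢ D
    C≢D eq = let i , i∈C = C≢∅ in _splits-into_,_.disjoint split (i , x∈p∩q⁺ (i∈C , subst (i ∈_) eq i∈C))

    splitCut : Cut P splitBlock
    splitCut = record
      { left = C ; right = D
      ; left-block = fromWitness (isLeft refl)
      ; right-block = fromWitness (isRight refl)
      ; left≢right = C≢D
      ; whole-block = subst (_∈ᵖ P) (sym (_splits-into_,_.union split)) S∈P
      ; other-block = λ p ne → fromWitness (isOther p λ { refl → ne (sym (_splits-into_,_.union split)) })
      }

  tree-nonempty : ∀ {Q S} → Tree Q S → Nonempty S
  tree-nonempty {Q} (leaf p) = Partition.nonempty Q (T-recompute p)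
  tree-nonempty (node _ p t _) with split-recompute p
  ... | splits refl _ = let i , i∈ = tree-nonempty t in i , p⊆p∪q _ i∈

  leaf-inv : ∀ {Q S} (t : Tree Q S) → (∀ {k} → ¬ k ∈ˡ labels t) → Σ[ p ∈ S ∈ᵖ Q ] t ≡ leaf p
  leaf-inv (leaf p) _ = T-recompute p , refl
  leaf-inv (node k p t u) none = contradiction (here refl) none

  relabel-id : ∀ {Q S} (f : ℕ → ℕ) (t : Tree Q S) → (∀ {k} → k ∈ˡ labels t → f k ≡ k) → relabel f t ≡ t
  relabel-id f (leaf p) _ = refl
  relabel-id f (node k p t u) fix
    rewrite fix (here refl)
          | relabel-id f t (λ x → fix (there (∈-++⁺ˡ x)))
          | relabel-id f u (λ x → fix (there (∈-++⁺ʳ (labels t) x))) = refl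

  relabel-∘ : ∀ {Q S} (f g : ℕ → ℕ) (t : Tree Q S) → relabel f (relabel g t) ≡ relabel (f ∘ g) t
  relabel-∘ f g (leaf p) = refl
  relabel-∘ f g (node k p t u) = cong₂ (node (f (g k)) p) (relabel-∘ f g t) (relabel-∘ f g u)

  pred-injective : ∀ {i j} → 0 < i → 0 < j → pred i ≡ pred j → i ≡ j
  pred-injective {suc i} {suc j} _ _ = cong suc

  pred-mono : ∀ {i j} → 0 < i → 0 < j → i < j → pred i < pred j
  pred-mono {suc i} {suc j} _ _ (s≤s lt) = lt

  unique-pred : ∀ {xs} → All (0 <_) xs → Unique xs → Unique (List.map pred xs)
  unique-pred [] [] = []
  unique-pred (p ∷ ps) (x ∷ u) =
    All.map⁺ (All.zipWith (λ (q , ne) eq → ne (pred-injective p q eq)) (ps , x)) ∷ unique-pred ps u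

  node-first : ∀ {Q S} (t : Tree Q S) → Increasing t → 0 ∈ˡ labels t →
    ∃[ C ] ∃[ D ] Σ[ p ∈ S splits-into C , D ] Σ[ u ∈ Tree Q C ] Σ[ v ∈ Tree Q D ] t ≡ node 0 p u v
  node-first (node k p t u) _ (here refl) = _ , _ , split-recompute p , t , u , refl
  node-first (node k p t u) (node kt ku _ _) (there x) with ∈-++⁻ (labels t) x
  ... | inj₁ y = contradiction (All.lookup kt y) λ ()
  ... | inj₂ y = contradiction (All.lookup ku y) λ ()

  module FirstCut {P Q} (F : Forest P Q) {m} (size-eq : Forest.size F ≡ suc m)
    {S C D} (S∈P : S ∈ᵖ P) (split : S splits-into C , D) (t : Tree Q C) (u : Tree Q D)
    (tree-eq : Forest.tree F S S∈P ≡ node 0 split t u) where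

    private module F = Forest F

    R : Partition
    R = splitBlock P S∈P split (tree-nonempty t) (tree-nonempty u)

    V : Cut P R
    V = splitCut P S∈P split (tree-nonempty t) (tree-nonempty u)

    KindR = Kind P S∈P split (tree-nonempty t) (tree-nonempty u)
    kindR? = kind? P S∈P split (tree-nonempty t) (tree-nonempty u)

    treeK : ∀ E → KindR E → Tree Q E
    treeK E (isLeft refl)  = t
    treeK E (isRight refl) = u
    treeK E (isOther p _)  = F.tree E p

    kindOf : ∀ {E} → .(E ∈ᵖ R) → KindR E
    kindOf {E} q = recompute (kindR? E) (toWitness q)

    tS : Tree Q S
    tS = F.tree S S∈P

    inS-l : ∀ {k} → k ∈ˡ labels t → k ∈ˡ labels tS
    inS-l x = subst (λ v → _ ∈ˡ labels v) (sym tree-eq) (there (∈-++⁺ˡ x))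

    inS-r : ∀ {k} → k ∈ˡ labels u → k ∈ˡ labels tS
    inS-r x = subst (λ v → _ ∈ˡ labels v) (sym tree-eq) (there (∈-++⁺ʳ (labels t) x))

    zero∈ : 0 ∈ˡ labels tS
    zero∈ = subst (λ v → _ ∈ˡ labels v) (sym tree-eq) (here refl)

    incS : Increasing (node 0 split t u)
    incS = subst Increasing tree-eq (F.increasing S S∈P)

    uniqS : Unique (labels t) × Unique (labels u) × (∀ {x} → x ∈ˡ labels t → ¬ x ∈ˡ labels u)
    uniqS with subst (λ v → Unique (labels v)) tree-eq (F.unique S S∈P)
    ... | _ ∷ w = unique-++⁻ (labels t) w

    positive : ∀ E κ → All (0 <_) (labels (treeK E κ))
    positive E (isLeft refl) with incS
    ... | node kt _ _ _ = kt
    positive E (isRight refl) with incS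
    ... | node _ ku _ _ = ku
    positive E (isOther p ne) = All.tabulate above0
      where
      above0 : ∀ {k} → k ∈ˡ labels (F.tree E p) → 0 < k
      above0 {zero}  x = contradiction (F.separated p S∈P x zero∈) ne
      above0 {suc k} x = s≤s z≤n

    incK : ∀ E κ → Increasing (treeK E κ)
    incK E (isLeft refl) with incS
    ... | node _ _ it _ = it
    incK E (isRight refl) with incS
    ... | node _ _ _ iu = iu
    incK E (isOther p ne) = F.increasing E p

    boundK : ∀ E κ → All (_< suc m) (labels (treeK E κ))
    boundK E (isLeft refl)  = All.tabulate λ x → subst (_ <_) size-eq (All.lookup (F.labelled S S∈P) (inS-l x))
    boundK E (isRight refl) = All.tabulate λ x → subst (_ <_) size-eq (All.lookup (F.labelled S S∈P) (inS-r x))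
    boundK E (isOther p ne) = subst (λ z → All (_< z) (labels (F.tree E p))) size-eq (F.labelled E p)

    uniqK : ∀ E κ → Unique (labels (treeK E κ))
    uniqK E (isLeft refl)  = proj₁ uniqS
    uniqK E (isRight refl) = proj₁ (proj₂ uniqS)
    uniqK E (isOther p ne) = F.unique E p

    sepK : ∀ {E E′ k} κ κ′ → k ∈ˡ labels (treeK E κ) → k ∈ˡ labels (treeK E′ κ′) → E ≡ E′
    sepK (isLeft refl) (isLeft refl) _ _ = refl
    sepK (isLeft refl) (isRight refl) x y = contradiction y (proj₂ (proj₂ uniqS) x)
    sepK (isLeft refl) (isOther p ne) x y = contradiction (F.separated p S∈P y (inS-l x)) ne
    sepK (isRight refl) (isLeft refl) x y = contradiction x (proj₂ (proj₂ uniqS) y)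
    sepK (isRight refl) (isRight refl) _ _ = refl
    sepK (isRight refl) (isOther p ne) x y = contradiction (F.separated p S∈P y (inS-r x)) ne
    sepK (isOther p ne) (isLeft refl) x y = contradiction (F.separated p S∈P x (inS-l y)) ne
    sepK (isOther p ne) (isRight refl) x y = contradiction (F.separated p S∈P x (inS-r y)) ne
    sepK (isOther p _) (isOther q _) x y = F.separated p q x y

    treeK-left : ∀ κ → treeK C κ ≡ t
    treeK-left (isLeft refl) = refl
    treeK-left (isRight eq) = contradiction eq (C≢D P S∈P split (tree-nonempty t) (tree-nonempty u))
    treeK-left (isOther p ne) = let i , i∈ = tree-nonempty t in
      contradiction (Partition.disjoint P p S∈P i∈ (splitˡ split i∈)) ne

    treeK-right : ∀ κ → treeK D κ ≡ u
    treeK-right (isLeft eq) = contradiction (sym eq) (C≢D P S∈P split (tree-nonempty t) (tree-nonempty u))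
    treeK-right (isRight refl) = refl
    treeK-right (isOther p ne) = let i , i∈ = tree-nonempty u in
      contradiction (Partition.disjoint P p S∈P i∈ (splitʳ split i∈)) ne

    treeK-other : ∀ {E} (p : E ∈ᵖ P) → E ≢ S → ∀ κ → treeK E κ ≡ F.tree E p
    treeK-other p ne (isLeft refl) = let i , i∈ = tree-nonempty t in
      contradiction (Partition.disjoint P p S∈P i∈ (splitˡ split i∈)) ne
    treeK-other p ne (isRight refl) = let i , i∈ = tree-nonempty u in
      contradiction (Partition.disjoint P p S∈P i∈ (splitʳ split i∈)) ne
    treeK-other p ne (isOther _ _) = refl

    rest : Forest R Q
    rest = record
      { size = m
      ; tree = λ E q → relabel pred (treeK E (kindOf q))
      ; increasing = λ E q → increasing-relabel pred (0 <_) pred-mono (treeK E (kindOf q)) (positive E (kindOf q)) (incK E (kindOf q))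
      ; labelled = λ E q → subst (All (_< m)) (sym (labels-relabel pred (treeK E (kindOf q))))
          (All.map⁺ (All.zipWith (λ { {suc k} (_ , s≤s lt) → lt ; {zero} (() , _) }) (positive E (kindOf q) , boundK E (kindOf q))))
      ; onto = onto
      ; unique = λ E q → subst Unique (sym (labels-relabel pred (treeK E (kindOf q))))
          (unique-pred (positive E (kindOf q)) (uniqK E (kindOf q)))
      ; separated = sep
      }
      where
      sep : ∀ {E E′ k} (q : E ∈ᵖ R) (q′ : E′ ∈ᵖ R) → k ∈ˡ labels (relabel pred (treeK E (kindOf q))) →
            k ∈ˡ labels (relabel pred (treeK E′ (kindOf q′))) → E ≡ E′
      sep {E} {E′} q q′ x y with ∈-relabel⁻ pred (treeK E (kindOf q)) x | ∈-relabel⁻ pred (treeK E′ (kindOf q′)) y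
      ... | i , i∈ , eq | j , j∈ , eq′ with pred-injective (All.lookup (positive E (kindOf q)) i∈) (All.lookup (positive E′ (kindOf q′)) j∈) (trans (sym eq) eq′)
      ...   | refl = sepK (kindOf q) (kindOf q′) i∈ j∈

      found : ∀ {E k} (q : E ∈ᵖ R) (v : Tree Q E) → (∀ κ → treeK E κ ≡ v) → suc k ∈ˡ labels v →
              ∃[ E ] Σ[ q ∈ E ∈ᵖ R ] k ∈ˡ labels (relabel pred (treeK E (kindOf q)))
      found {E} q v eq x = E , q , ∈-relabel⁺ pred _ (subst (λ w → _ ∈ˡ labels w) (sym (eq (kindOf q))) x)

      onto : ∀ {k} → k < m → ∃[ E ] Σ[ q ∈ E ∈ᵖ R ] k ∈ˡ labels (relabel pred (treeK E (kindOf q)))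
      onto k<m with F.onto (subst (_ <_) (sym size-eq) (s≤s k<m))
      ... | E , p , x with E ≟ˢ S
      ...   | no ne = found (fromWitness (isOther p ne)) _ (treeK-other p ne) x
      ...   | yes refl with subst (λ v → _ ∈ˡ labels v) tree-eq x
      ...     | there y with ∈-++⁻ (labels t) y
      ...       | inj₁ z = found (fromWitness (isLeft refl)) t treeK-left z
      ...       | inj₂ z = found (fromWitness (isRight refl)) u treeK-right z

    private
      back : ∀ {E} κ (v : Tree Q E) → treeK E κ ≡ v → relabel suc (relabel pred (treeK E κ)) ≡ v
      back {E} κ v refl = trans (relabel-∘ suc pred (treeK E κ))
        (relabel-id _ _ λ x → suc-pred (All.lookup (positive E κ) x))
        where
        suc-pred : ∀ {k} → 0 < k → suc (pred k) ≡ k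
        suc-pred {suc k} _ = refl

    rest-≈ : (G : Forest R Q) → G ≈ᶠ rest → (cut V ∘ᶠ G) ≈ᶠ F
    rest-≈ G eq = record
      { size-≡ = trans (cong suc size-≡) (sym size-eq)
      ; tree-≡ = λ E p → go E p (E ≟ˢ C ∪ D)
      }
      where
      open _≈ᶠ_ eq
      shifted : ∀ E → .(E ∈ᵖ R) → Tree Q E
      shifted E q = relabel suc (Forest.tree G E q)
      part : ∀ {E} (q : E ∈ᵖ R) (v : Tree Q E) → (∀ κ → treeK E κ ≡ v) → shifted E q ≡ v
      part {E} q v all = trans (cong (relabel suc) (tree-≡ E q)) (back (kindOf q) v (all (kindOf q)))
      go : ∀ E (p : E ∈ᵖ P) d → graft (CutTree.cutTree V E p d) shifted ≡ F.tree E p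
      go E p (no ne) = part (Cut.other-block V p ne) _
        (treeK-other p λ eq → ne (trans eq (sym (_splits-into_,_.union split))))
      go E p (yes E≡) with trans E≡ (_splits-into_,_.union split)
      ... | refl = trans (cong₂ (node 0 split)
                           (part (Cut.left-block V) t treeK-left)
                           (part (Cut.right-block V) u treeK-right))
                         (sym tree-eq)

  factorisation : ∀ {P Q} (F : Forest P Q) → Σ[ Vs ∈ Cuts P Q ] composite Vs ≈ᶠ F
  factorisation {P} {Q} F = go _ F refl
    where
    go : ∀ {P} m (F : Forest P Q) → Forest.size F ≡ m → Σ[ Vs ∈ Cuts P Q ] composite Vs ≈ᶠ F
    go {P} zero F size≡0 = [] (P⊆Q , Q⊆P) , record
      { size-≡ = sym size≡0 ; tree-≡ = λ S p → sym (proj₂ (isLeaf p)) }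
      where
      open Forest F
      none : ∀ {S k} (p : S ∈ᵖ P) → ¬ k ∈ˡ labels (tree S p)
      none p x with subst (_ <_) size≡0 (All.lookup (labelled _ p) x)
      ... | ()
      isLeaf : ∀ {S} (p : S ∈ᵖ P) → Σ[ q ∈ S ∈ᵖ Q ] tree S p ≡ leaf q
      isLeaf p = leaf-inv (tree _ p) (none p)
      P⊆Q : ∀ {S} → S ∈ᵖ P → S ∈ᵖ Q
      P⊆Q p = proj₁ (isLeaf p)
      Q⊆P : ∀ {S} → S ∈ᵖ Q → S ∈ᵖ P
      Q⊆P q with Partition.nonempty Q q
      ... | i , i∈S with Partition.cover P i
      ...   | E , p , i∈E with Partition.disjoint Q q (P⊆Q p) i∈S i∈E
      ...     | refl = p
    go (suc m) F size≡ with Forest.onto F (subst (0 <_) (sym size≡) (s≤s z≤n))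
    ... | S , p , 0∈ with node-first (Forest.tree F S p) (Forest.increasing F S p) 0∈
    ...   | C , D , split , t , u , eq with go m (FirstCut.rest F size≡ p split t u eq) refl
    ...     | Vs , Vs≈ = FirstCut.V F size≡ p split t u eq ∷ Vs , FirstCut.rest-≈ F size≡ p split t u eq (composite Vs) Vs≈

  splits-swap : ∀ {S C D} → S splits-into C , D → S splits-into D , C
  splits-swap {S} {C} {D} (splits u e) =
    splits (trans (∪-comm D C) u) (subst Empty (∩-comm C D) e)

  switchTree : ∀ {Q S} → (ℕ → Bool) → Tree Q S → Tree Q S
  switchTree ε (leaf p)       = leaf p
  switchTree ε (node k p t u) =
    if ε k then node k (splits-swap p) (switchTree ε u) (switchTree ε t)
           else node k p (switchTree ε t) (switchTree ε u)

  labels-switch : ∀ {Q S} ε (t : Tree Q S) → labels (switchTree ε t) ↭ labels t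
  labels-switch ε (leaf p) = ↭-refl
  labels-switch ε (node k p t u) with ε k
  ... | true  = ↭-prep k (↭-trans (++⁺ (labels-switch ε u) (labels-switch ε t)) (++-comm (labels u) (labels t)))
  ... | false = ↭-prep k (++⁺ (labels-switch ε t) (labels-switch ε u))

  increasing-switch : ∀ {Q S} ε (t : Tree Q S) → Increasing t → Increasing (switchTree ε t)
  increasing-switch ε (leaf p) leaf = leaf
  increasing-switch ε (node k p t u) (node kt ku it iu)
    with ε k | All-resp-↭ (↭-sym (labels-switch ε t)) kt | All-resp-↭ (↭-sym (labels-switch ε u)) ku
  ... | true  | kt′ | ku′ = node ku′ kt′ (increasing-switch ε u iu) (increasing-switch ε t it)
  ... | false | kt′ | ku′ = node kt′ ku′ (increasing-switch ε t it) (increasing-switch ε u iu)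

  -- does the node with the given label belong to the subset?
  layer : ∀ {l} → Subset l → ℕ → Bool
  layer []      _       = false
  layer (b ∷ ε) zero    = b
  layer (b ∷ ε) (suc k) = layer ε k

  -- switches left and right at the nodes whose labels belong to ε
  switch : ∀ {P Q} (F : Forest P Q) → Subset (Forest.size F) → Forest P Q
  switch {P} {Q} F ε = record
    { size = size
    ; tree = λ S p → sw (tree S p)
    ; increasing = λ S p → increasing-switch (layer ε) (tree S p) (increasing S p)
    ; labelled = λ S p → All-resp-↭ (↭-sym (perm (tree S p))) (labelled S p)
    ; onto = λ k< → let S , p , k∈ = onto k< in S , p , ∈-resp-↭ (↭-sym (perm (tree S p))) k∈
    ; unique = λ S p → Unique-resp-↭ (↭-sym (perm (tree S p))) (unique S p)
    ; separated = λ p p′ x y → separated p p′ (∈-resp-↭ (perm (tree _ p)) x) (∈-resp-↭ (perm (tree _ p′)) y)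
    }
    where
    open Forest F
    sw : ∀ {S} → Tree Q S → Tree Q S
    sw = switchTree (layer ε)
    perm : ∀ {S} (t : Tree Q S) → labels (sw t) ↭ labels t
    perm = labels-switch (layer ε)

  allSubsets : ∀ l → List (Subset l)
  allSubsets zero    = [] ∷ []
  allSubsets (suc l) = List.map (outside ∷_) (allSubsets l) ++ List.map (inside ∷_) (allSubsets l)

module Arrangement {ℓ} (R : OrderedField ℓ) (n : ℕ) .{{_ : NonZero n}} where
  open OrderedField R hiding (zero)
  open Signs R
  open Partitions n
  open Sum semiring using (sum; ∑-distrib-+; sum-cong-≋; *-distribˡ-sum)
  open RingProperties ring using (-‿involutive)

  Point : Set ℓ
  Point = Vector Carrier n

  sumOver : ∀ {m} → Subset m → Vector Carrier m → Carrier
  sumOver S h = sum (λ i → if lookup S i then h i else 0#)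

  -- the semisimple flat of P, as a set of points
  T∨ : Partition → Pred Point ℓ
  T∨ P h = ∀ S → S ∈ᵖ P → sumOver S h ≈ 0#

  ambient : Pred Point ℓ
  ambient = T∨ oneBlock

  record Hyperplane : Set where
    field
      subset   : Subset n
      nonempty : Nonempty subset
      proper   : subset ≢ ⊤

  open Hyperplane using (subset)

  ⟦_⟧ : Hyperplane → Pred Point ℓ
  ⟦ H ⟧ h = ambient h × sumOver (subset H) h ≈ 0#

  record Flat : Set (lsuc ℓ) where
    field
      space          : Pred Point ℓ
      isIntersection : ∃ λ (𝓗 : Pred Hyperplane 0ℓ) → space ≐ λ h → ambient h × ∀ H → 𝓗 H → ⟦ H ⟧ h

  open Flat public using (space)

  private
    open module ≈R = SetoidReasoning setoid

  term : ∀ {m} → Subset m → Vector Carrier m → Fin m → Carrier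
  term S h i = if lookup S i then h i else 0#

  lookup-out : ∀ {m} {S : Subset m} {i} → i ∉ S → lookup S i ≡ false
  lookup-out {S = S} {i} i∉ with lookup S i in eq
  ... | true  = contradiction (lookup⇒[]= i S eq) i∉
  ... | false = ≡.refl

  term-in : ∀ {m} {S : Subset m} {i} (h : Vector Carrier m) → i ∈ S → term S h i ≈ h i
  term-in {S = S} {i} h i∈ rewrite []=⇒lookup i∈ = refl

  term-out : ∀ {m} {S : Subset m} {i} (h : Vector Carrier m) → i ∉ S → term S h i ≈ 0#
  term-out {S = S} {i} h i∉ rewrite lookup-out {S = S} i∉ = refl

  combine : ∀ {m} → Carrier → Vector Carrier m → Vector Carrier m → Vector Carrier m
  combine K x y i = K * x i + y i

  sumOver-cong : ∀ {m} (S : Subset m) {x y : Vector Carrier m} → (∀ i → x i ≈ y i) → sumOver S x ≈ sumOver S y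
  sumOver-cong S e = sum-cong-≋ λ i → lem (lookup S i) (e i)
    where
    lem : ∀ b {x y} → x ≈ y → (if b then x else 0#) ≈ (if b then y else 0#)
    lem true  e = e
    lem false e = refl

  sumOver-combine : ∀ {m} (S : Subset m) K x y → sumOver S (combine K x y) ≈ K * sumOver S x + sumOver S y
  sumOver-combine S K x y = begin
    sum (term S (combine K x y))                     ≈⟨ sum-cong-≋ (λ i → lem (lookup S i)) ⟩
    sum (λ i → K * term S x i + term S y i)          ≈⟨ ∑-distrib-+ (λ i → K * term S x i) (term S y) ⟩
    sum (λ i → K * term S x i) + sum (term S y)      ≈⟨ +-congʳ (sym (*-distribˡ-sum K (term S x))) ⟩
    K * sum (term S x) + sum (term S y)              ∎
    where
    lem : ∀ b {x y} → (if b then K * x + y else 0#) ≈ K * (if b then x else 0#) + (if b then y else 0#)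
    lem true  = refl
    lem false = sym (trans (+-identityʳ _) (zeroʳ K))

  sum-zero : ∀ {m} (x : Vector Carrier m) → (∀ i → x i ≈ 0#) → sum x ≈ 0#
  sum-zero {Nat.zero}  x e = refl
  sum-zero {Nat.suc m} x e = trans (+-cong (e zero) (sum-zero (x ∘ suc) (e ∘ suc))) (+-identityˡ 0#)

  sumOver-zero : ∀ {m} (S : Subset m) {h : Vector Carrier m} → (∀ i → h i ≈ 0#) → sumOver S h ≈ 0#
  sumOver-zero S e = sum-zero _ λ i → lem (lookup S i) (e i)
    where
    lem : ∀ b {y} → y ≈ 0# → (if b then y else 0#) ≈ 0#
    lem true e  = e
    lem false e = refl

  sumOver-empty : ∀ {m} (S : Subset m) h → (∀ {i} → i ∉ S) → sumOver S h ≈ 0#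
  sumOver-empty S h e = sum-zero (term S h) λ i → term-out h e

  sumOver-split : ∀ {m} (S U : Subset m) h → U ⊆ S → sumOver S h ≈ sumOver U h + sumOver (S ∩ ∁ U) h
  sumOver-split S U h U⊆S = trans (sum-cong-≋ each) (∑-distrib-+ (term U h) (term (S ∩ ∁ U) h))
    where
    each : ∀ i → term S h i ≈ term U h i + term (S ∩ ∁ U) h i
    each i with i ∈? U | i ∈? S
    ... | yes i∈U | _ = begin
      term S h i                        ≈⟨ term-in h (U⊆S i∈U) ⟩
      h i                               ≈⟨ +-identityʳ (h i) ⟨
      h i + 0#                          ≈⟨ +-cong (term-in h i∈U) (term-out h (λ x → x∈∁p⇒x∉p (proj₂ (x∈p∩q⁻ S _ x)) i∈U)) ⟨
      term U h i + term (S ∩ ∁ U) h i   ∎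
    ... | no i∉U | yes i∈S = begin
      term S h i                        ≈⟨ term-in h i∈S ⟩
      h i                               ≈⟨ +-identityˡ (h i) ⟨
      0# + h i                          ≈⟨ +-cong (term-out h i∉U) (term-in h (x∈p∩q⁺ (i∈S , x∉p⇒x∈∁p i∉U))) ⟨
      term U h i + term (S ∩ ∁ U) h i   ∎
    ... | no i∉U | no i∉S = begin
      term S h i                        ≈⟨ term-out h i∉S ⟩
      0#                                ≈⟨ +-identityˡ 0# ⟨
      0# + 0#                           ≈⟨ +-cong (term-out h i∉U) (term-out h (λ x → i∉S (proj₁ (x∈p∩q⁻ S _ x)))) ⟨
      term U h i + term (S ∩ ∁ U) h i   ∎

  unit : ∀ {m} → Fin m → Vector Carrier m
  unit j i = if lookup ⁅ j ⁆ i then 1# else 0#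

  sumOver-unit : ∀ {m} (S : Subset m) j → sumOver S (unit j) ≈ (if lookup S j then 1# else 0#)
  sumOver-unit (s ∷ S) zero = trans (+-congˡ (sum-zero _ zeros)) (+-identityʳ _)
    where
    zeros : ∀ i → term S (unit zero ∘ suc) i ≈ 0#
    zeros i with lookup S i
    ... | false = refl
    ... | true rewrite lookup-replicate i outside = refl
  sumOver-unit (s ∷ S) (suc j) = trans (+-cong (lem s) (sumOver-unit S j)) (+-identityˡ _)
    where
    lem : ∀ b → (if b then 0# else 0#) ≈ 0#
    lem true  = refl
    lem false = refl

  unit-in : ∀ {m} {S : Subset m} {j} → j ∈ S → sumOver S (unit j) ≈ 1#
  unit-in {S = S} {j} j∈ = trans (sumOver-unit S j) (term-in (λ _ → 1#) j∈)

  unit-out : ∀ {m} {S : Subset m} {j} → j ∉ S → sumOver S (unit j) ≈ 0#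
  unit-out {S = S} {j} j∉ = trans (sumOver-unit S j) (term-out {S = S} (λ _ → 1#) j∉)

  difference : Fin n → Fin n → Point
  difference i j = combine (- 1#) (unit j) (unit i)

  difference-in : ∀ {S i j} → i ∈ S → j ∉ S → sumOver S (difference i j) ≈ 1#
  difference-in {S} {i} {j} i∈ j∉ = begin
    sumOver S (difference i j)                          ≈⟨ sumOver-combine S (- 1#) (unit j) (unit i) ⟩
    - 1# * sumOver S (unit j) + sumOver S (unit i)      ≈⟨ +-cong (*-congˡ (unit-out j∉)) (unit-in i∈) ⟩
    - 1# * 0# + 1#                                      ≈⟨ +-congʳ (zeroʳ _) ⟩
    0# + 1#                                             ≈⟨ +-identityˡ 1# ⟩
    1#                                                  ∎

  difference-out : ∀ {S i j} → i ∉ S → j ∈ S → sumOver S (difference i j) ≈ - 1#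
  difference-out {S} {i} {j} i∉ j∈ = begin
    sumOver S (difference i j)                          ≈⟨ sumOver-combine S (- 1#) (unit j) (unit i) ⟩
    - 1# * sumOver S (unit j) + sumOver S (unit i)      ≈⟨ +-cong (*-congˡ (unit-in j∈)) (unit-out i∉) ⟩
    - 1# * 1# + 0#                                      ≈⟨ +-identityʳ _ ⟩
    - 1# * 1#                                           ≈⟨ *-identityʳ _ ⟩
    - 1#                                                ∎

  difference-both : ∀ {S i j} → i ∈ S → j ∈ S → sumOver S (difference i j) ≈ 0#
  difference-both {S} {i} {j} i∈ j∈ = begin
    sumOver S (difference i j)                          ≈⟨ sumOver-combine S (- 1#) (unit j) (unit i) ⟩
    - 1# * sumOver S (unit j) + sumOver S (unit i)      ≈⟨ +-cong (*-congˡ (unit-in j∈)) (unit-in i∈) ⟩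
    - 1# * 1# + 1#                                      ≈⟨ +-congʳ (*-identityʳ _) ⟩
    - 1# + 1#                                           ≈⟨ -‿inverseˡ 1# ⟩
    0#                                                  ∎

  difference-neither : ∀ {S i j} → i ∉ S → j ∉ S → sumOver S (difference i j) ≈ 0#
  difference-neither {S} {i} {j} i∉ j∉ = begin
    sumOver S (difference i j)                          ≈⟨ sumOver-combine S (- 1#) (unit j) (unit i) ⟩
    - 1# * sumOver S (unit j) + sumOver S (unit i)      ≈⟨ +-cong (*-congˡ (unit-out j∉)) (unit-out i∉) ⟩
    - 1# * 0# + 0#                                      ≈⟨ +-identityʳ _ ⟩
    - 1# * 0#                                           ≈⟨ zeroʳ _ ⟩
    0#                                                  ∎

  difference-T∨ : ∀ {P B i j} → B ∈ᵖ P → i ∈ B → j ∈ B → T∨ P (difference i j)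
  difference-T∨ {P} {B} {i} {j} B∈ i∈ j∈ S S∈ with i ∈? S | j ∈? S
  ... | yes i∈S | yes j∈S = difference-both {S} i∈S j∈S
  ... | no i∉S  | no j∉S  = difference-neither {S} i∉S j∉S
  ... | yes i∈S | no j∉S with Partition.disjoint P B∈ S∈ i∈ i∈S
  ...   | ≡.refl = contradiction j∈ j∉S
  difference-T∨ {P} {B} {i} {j} B∈ i∈ j∈ S S∈ | no i∉S | yes j∈S with Partition.disjoint P B∈ S∈ j∈ j∈S
  ...   | ≡.refl = contradiction i∈ i∉S

  -- S is a union of blocks of P; see saturated⇒mod
  Saturated : Partition → Subset n → Set
  Saturated P S = ∀ {B i} → B ∈ᵖ P → i ∈ B → i ∈ S → B ⊆ S

  block-∈ : ∀ P i → blockOf P i ∈ᵖ P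
  block-∈ P i = proj₁ (proj₂ (Partition.cover P i))

  ∈-block : ∀ P i → i ∈ blockOf P i
  ∈-block P i = proj₂ (proj₂ (Partition.cover P i))

  block-≡ : ∀ P {B i} → B ∈ᵖ P → i ∈ B → blockOf P i ≡ B
  block-≡ P B∈ i∈ = Partition.disjoint P (block-∈ P _) B∈ (∈-block P _) i∈

  ∈-Redn⁺ : ∀ P {E i} → i ∈ E → ¬ blockOf P i ⊆ E → i ∈ Redn P E
  ∈-Redn⁺ P {E} {i} i∈ n = lookup⇒[]= i _ (≡.trans (lookup∘tabulate _ i)
    (≡.cong₂ (λ a b → a ∧ not b) ([]=⇒lookup i∈) (≡.trans (isYes≗does (blockOf P i ⊆? E)) (dec-false (blockOf P i ⊆? E) n))))

  ∈-Redn⁻ : ∀ P {E i} → i ∈ Redn P E → i ∈ E × ¬ blockOf P i ⊆ E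
  ∈-Redn⁻ P {E} {i} i∈ with ≡.trans (≡.sym (lookup∘tabulate _ i)) ([]=⇒lookup i∈)
  ... | eq with lookup E i in e | blockOf P i ⊆? E
  ...   | true | no n = lookup⇒[]= i E e , n
  ∈-Redn⁻ P {E} {i} i∈ | () | true  | yes _
  ∈-Redn⁻ P {E} {i} i∈ | () | false | _

  saturated⇒mod : ∀ {P S} → Saturated P S → S ≡ ⊥ mod P
  saturated⇒mod {P} {S} sat = ≡.trans
    (Empty-unique λ (i , i∈) → let i∈S , n = ∈-Redn⁻ P i∈ in n (sat (block-∈ P i) (∈-block P i) i∈S))
    (≡.sym (Empty-unique λ (i , i∈) → ∉⊥ (proj₁ (∈-Redn⁻ P i∈))))

  mod⇒saturated : ∀ {P S} → S ≡ ⊥ mod P → Saturated P S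
  mod⇒saturated {P} {S} eq {B} {i} B∈ i∈B i∈S =
    ≡.subst (_⊆ S) (block-≡ P B∈ i∈B) (decidable-stable (blockOf P i ⊆? S) λ n →
      ∉⊥ (proj₁ (∈-Redn⁻ P {⊥} (≡.subst (i ∈_) eq (∈-Redn⁺ P i∈S n)))))

  vanish : ∀ {P S h} → T∨ P h → Saturated P S → sumOver S h ≈ 0#
  vanish {P} {S₀} {h} h∈ sat₀ = go (allFin n) S₀ sat₀ λ {i} _ → ∈-allFin i
    where
    go : ∀ xs S → Saturated P S → (∀ {i} → i ∈ S → i ∈ˡ xs) → sumOver S h ≈ 0#
    go [] S sat sub = sumOver-empty S h λ i∈ → contradiction (sub i∈) λ ()
    go (x ∷ xs) S sat sub with x ∈? S
    ... | no x∉ = go xs S sat λ i∈ → tail i∈ (sub i∈)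
      where
      tail : ∀ {i} → i ∈ S → i ∈ˡ x ∷ xs → i ∈ˡ xs
      tail i∈ (here ≡.refl) = contradiction i∈ x∉
      tail i∈ (there y) = y
    ... | yes x∈ = begin
      sumOver S h                      ≈⟨ sumOver-split S B h (sat (block-∈ P x) (∈-block P x) x∈) ⟩
      sumOver B h + sumOver S′ h       ≈⟨ +-cong (h∈ B (block-∈ P x)) (go xs S′ sat′ sub′) ⟩
      0# + 0#                          ≈⟨ +-identityˡ 0# ⟩
      0#                               ∎
      where
      B  = blockOf P x
      S′ = S ∩ ∁ B
      sat′ : Saturated P S′
      sat′ {B′} {i} B′∈ i∈B′ i∈S′ {j} j∈B′ = x∈p∩q⁺
        ( sat B′∈ i∈B′ (proj₁ (x∈p∩q⁻ S (∁ B) i∈S′)) j∈B′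
        , x∉p⇒x∈∁p λ j∈B → x∈∁p⇒x∉p (proj₂ (x∈p∩q⁻ S (∁ B) i∈S′))
            (≡.subst (i ∈_) (Partition.disjoint P B′∈ (block-∈ P x) j∈B′ j∈B) i∈B′))
      sub′ : ∀ {i} → i ∈ S′ → i ∈ˡ xs
      sub′ i∈ with sub (proj₁ (x∈p∩q⁻ S (∁ B) i∈))
      ... | here ≡.refl = contradiction (∈-block P x) (x∈∁p⇒x∉p (proj₂ (x∈p∩q⁻ S (∁ B) i∈)))
      ... | there y = y

  sumOver-Redn : ∀ {P h} → T∨ P h → ∀ S → sumOver S h ≈ sumOver (Redn P S) h
  sumOver-Redn {P} {h} h∈ S = begin
    sumOver S h                        ≈⟨ sumOver-split S (Redn P S) h (λ i∈ → proj₁ (∈-Redn⁻ P i∈)) ⟩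
    sumOver (Redn P S) h + sumOver U h ≈⟨ +-congˡ (vanish {P} {U} h∈ sat) ⟩
    sumOver (Redn P S) h + 0#          ≈⟨ +-identityʳ _ ⟩
    sumOver (Redn P S) h               ∎
    where
    U = S ∩ ∁ (Redn P S)
    sat : Saturated P U
    sat {B} {i} B∈ i∈B i∈U {j} j∈B = x∈p∩q⁺ (B⊆S j∈B , x∉p⇒x∈∁p λ j∈ →
      proj₂ (∈-Redn⁻ P j∈) (≡.subst (_⊆ S) (≡.sym (block-≡ P B∈ j∈B)) B⊆S))
      where
      i∈S∖ = x∈p∩q⁻ S (∁ (Redn P S)) i∈U
      B⊆S : B ⊆ S
      B⊆S = ≡.subst (_⊆ S) (block-≡ P B∈ i∈B) (decidable-stable (blockOf P i ⊆? S) λ n →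
        x∈∁p⇒x∉p (proj₂ i∈S∖) (∈-Redn⁺ P (proj₁ i∈S∖) n))

  sumOver-mod : ∀ {P h S S′} → T∨ P h → S ≡ S′ mod P → sumOver S h ≈ sumOver S′ h
  sumOver-mod {P} {h} {S} {S′} h∈ eq =
    trans (sumOver-Redn {P} h∈ S) (trans (reflexive (≡.cong (λ E → sumOver E h) eq)) (sym (sumOver-Redn {P} h∈ S′)))

  flat-saturated : ∀ {P S} → (∀ {h} → T∨ P h → sumOver S h ≈ 0#) → Saturated P S
  flat-saturated {P} {S} zeros {B} {i} B∈ i∈B i∈S {j} j∈B = decidable-stable (j ∈? S) λ j∉S →
    1≉0 (trans (sym (difference-in {S} i∈S j∉S)) (zeros (difference-T∨ {P} B∈ i∈B j∈B)))

  ⊤-saturated : ∀ {P} → Saturated P ⊤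
  ⊤-saturated _ _ _ _ = ∈⊤

  T∨⊑ambient : ∀ {P} → T∨ P ⊑ ambient
  T∨⊑ambient {P} h∈ S p = trans (reflexive (≡.cong (λ E → sumOver E _) (toWitness p)))
                              (vanish {P} {⊤} h∈ (⊤-saturated {P}))

  T∨-combine : ∀ {P K x y} → T∨ P x → T∨ P y → T∨ P (combine K x y)
  T∨-combine {P} {K} {x} {y} x∈ y∈ S p = trans (sumOver-combine S K x y)
    (trans (+-cong (trans (*-congˡ (x∈ S p)) (zeroʳ K)) (y∈ S p)) (+-identityˡ 0#))

  flat : Partition → Flat
  flat P = record
    { space = T∨ P
    ; isIntersection = (λ H → subset H ∈ᵖ P) , to , from
    }
    where
    to : T∨ P ⊑ λ h → ambient h × ∀ (H : Hyperplane) → subset H ∈ᵖ P → ⟦ H ⟧ h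
    to h∈ = T∨⊑ambient {P} h∈ , λ H p → T∨⊑ambient {P} h∈ , h∈ _ p
    from : (λ h → ambient h × ∀ (H : Hyperplane) → subset H ∈ᵖ P → ⟦ H ⟧ h) ⊑ T∨ P
    from (amb , hyps) S p with S ≟ˢ ⊤
    ... | yes eq = amb S (fromWitness {a? = S ≟ˢ ⊤} eq)
    ... | no ne  = proj₂ (hyps (record { subset = S ; nonempty = Partition.nonempty P p ; proper = ne }) p)

  T∨-≐ : ∀ {P Q} → P ≐ᵖ Q → T∨ Q ≐ T∨ P
  T∨-≐ (P⊆Q , Q⊆P) = (λ h∈ S p → h∈ S (P⊆Q p)) , (λ h∈ S q → h∈ S (Q⊆P q))

module Lunes {ℓ} (R : OrderedField ℓ) (n : ℕ) .{{_ : NonZero n}} where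
  open OrderedField R hiding (zero)
  open Signs R
  open Partitions n
  open RingProperties ring using (-‿involutive; -‿distribˡ-*; -1*x≈-x)
  open Arrangement R n
  open Hyperplane using (subset)
  private
    open module ≈R = SetoidReasoning setoid

  -- the hyperplanes that cut out the lunes with case A and base B
  between : Flat → Flat → Pred Hyperplane ℓ
  between A B H = space B ⊑ ⟦ H ⟧ × ¬ (space A ⊑ ⟦ H ⟧)

  -- x lies in the closed half-space of H that contains h
  OnSide : Point → Hyperplane → Pred Point ℓ
  OnSide h H x = 0# ≤ sumOver (subset H) x * sumOver (subset H) h

  -- X is the closure of the chamber through h of the arrangement cut out in A by 𝓗,
  -- that is, the intersection of the closed half-spaces containing h.
  IsClosedChamber : ∀ {a} → Flat → Pred Hyperplane a → Pred Point (ℓ ⊔ a) → Set (ℓ ⊔ a)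
  IsClosedChamber A 𝓗 X = ∃[ h ] space A h × (∀ H → 𝓗 H → ¬ ⟦ H ⟧ h) ×
    (X ≐ λ x → space A x × ∀ H → 𝓗 H → OnSide h H x)

  -- case A, base B
  record Lune (A B : Flat) : Set (lsuc ℓ) where
    field
      base⊆case       : space B ⊑ space A
      region          : Pred Point ℓ
      isClosedChamber : IsClosedChamber A (between A B) region

    interior : Point
    interior = proj₁ isClosedChamber

  open Lune using (region)

  infix 4 _≈ᴸ_
  _≈ᴸ_ : ∀ {A B} → Lune A B → Lune A B → Set ℓ
  M ≈ᴸ N = region M ≐ region N

  luneSetoid : Flat → Flat → Setoid _ _
  luneSetoid A B = record
    { Carrier = Lune A B
    ; _≈_ = _≈ᴸ_
    ; isEquivalence = record { refl = ≐-refl ; sym = ≐-sym ; trans = ≐-trans }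
    }

  flat⊑ambient : ∀ A → space A ⊑ ambient
  flat⊑ambient A x∈ = proj₁ (proj₁ (proj₂ (Flat.isIntersection A)) x∈)

  flat-combine : ∀ A {K x y} → space A x → space A y → space A (combine K x y)
  flat-combine A {K} {x} {y} x∈ y∈ with Flat.isIntersection A
  ... | 𝓗 , to , from = from (amb (proj₁ (to x∈)) (proj₁ (to y∈)) , λ H p →
          amb (proj₁ (to x∈)) (proj₁ (to y∈)) ,
          trans (sumOver-combine (subset H) K x y)
            (trans (+-cong (trans (*-congˡ (proj₂ (proj₂ (to x∈) H p))) (zeroʳ K)) (proj₂ (proj₂ (to y∈) H p)))
                   (+-identityˡ 0#)))
    where
    amb : ambient x → ambient y → ambient (combine K x y)
    amb = T∨-combine {oneBlock}

  ⊑-stable : ∀ A H → ¬ ¬ (space A ⊑ ⟦ H ⟧) → space A ⊑ ⟦ H ⟧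
  ⊑-stable A H nn x∈ = flat⊑ambient A x∈ ,
    decidable-stable (sumOver (subset H) _ ≟ 0#) λ x∉ → nn λ A⊑H → x∉ (proj₂ (A⊑H x∈))

  IsComposite : ∀ {A B C} → Lune B C → Lune A B → Lune A C → Set ℓ
  IsComposite L M N = region L ⊑ region N × region N ⊑ region M

  ∃!composite : ∀ {A B C} (L : Lune B C) (M : Lune A B) →
    Σ[ N ∈ Lune A C ] IsComposite L M N × (∀ N′ → IsComposite L M N′ → N ≈ᴸ N′)
  ∃!composite {A} {B} {C} L M = N , (L⊑N , N⊑M) , unique
    where
    module L = Lune L
    module M = Lune M
    l = proj₁ L.isClosedChamber
    m = proj₁ M.isClosedChamber
    l∈B = proj₁ (proj₂ L.isClosedChamber)
    m∈A = proj₁ (proj₂ M.isClosedChamber)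
    l∉ = proj₁ (proj₂ (proj₂ L.isClosedChamber))
    m∉ = proj₁ (proj₂ (proj₂ M.isClosedChamber))
    L≐ = proj₂ (proj₂ (proj₂ L.isClosedChamber))
    M≐ = proj₂ (proj₂ (proj₂ M.isClosedChamber))

    K = proj₁ (perturb (λ S → sumOver S l) (λ S → sumOver S m))
    n₀ = combine K l m
    n∈A : space A n₀
    n∈A = flat-combine A (M.base⊆case l∈B) m∈A

    off : ∀ {H} → ¬ sumOver (subset H) l ≈ 0# → sgn (sumOver (subset H) n₀) ≡ sgn (sumOver (subset H) l)
    off {H} l≉ = ≡.trans (sgn-cong (sumOver-combine (subset H) K l m))
      (proj₂ (perturb (λ S → sumOver S l) (λ S → sumOver S m)) (subset H) l≉)

    on : ∀ {H} → sumOver (subset H) l ≈ 0# → sumOver (subset H) n₀ ≈ sumOver (subset H) m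
    on {H} l≈ = trans (sumOver-combine (subset H) K l m)
      (trans (+-congʳ (trans (*-congˡ l≈) (zeroʳ K))) (+-identityˡ _))

    B⊑ : ∀ {H} → space C ⊑ ⟦ H ⟧ → sumOver (subset H) l ≈ 0# → space B ⊑ ⟦ H ⟧
    B⊑ {H} C⊑H l≈ = ⊑-stable B H λ n → l∉ H (C⊑H , n) (flat⊑ambient B l∈B , l≈)

    n∉ : ∀ H → between A C H → ¬ sumOver (subset H) n₀ ≈ 0#
    n∉ H (C⊑H , A⋢H) n≈ with sumOver (subset H) l ≟ 0#
    ... | yes l≈ = m∉ H (B⊑ {H} C⊑H l≈ , A⋢H) (flat⊑ambient A m∈A , trans (sym (on {H} l≈)) n≈)
    ... | no l≉  = l≉ (zer-sgn (≡.trans (≡.sym (off {H} l≉)) (sgn-zer n≈)))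

    N : Lune A C
    N = record
      { base⊆case = λ x∈ → M.base⊆case (L.base⊆case x∈)
      ; region = λ x → space A x × ∀ H → between A C H → OnSide n₀ H x
      ; isClosedChamber = n₀ , n∈A , (λ H b n∈H → n∉ H b (proj₂ n∈H)) , ≐-refl
      }

    L⊑N : region L ⊑ region N
    L⊑N {x} x∈L = M.base⊆case x∈B , side
      where
      x∈B = proj₁ (proj₁ L≐ x∈L)
      side : ∀ H → between A C H → OnSide n₀ H x
      side H (C⊑H , A⋢H) with sumOver (subset H) l ≟ 0#
      ... | yes l≈ = zero-side (proj₂ (B⊑ {H} C⊑H l≈ x∈B))
      ... | no l≉  = side-cong ≡.refl (≡.sym (off {H} l≉))
                       (proj₂ (proj₁ L≐ x∈L) H (C⊑H , λ B⊑H → l≉ (proj₂ (B⊑H l∈B))))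

    N⊑M : region N ⊑ region M
    N⊑M {x} (x∈A , sides) = proj₂ M≐ (x∈A , λ H (B⊑H , A⋢H) →
      side-cong {sumOver (subset H) x} ≡.refl (sgn-cong (on {H} (proj₂ (B⊑H l∈B))))
        (sides H ((λ y∈C → B⊑H (L.base⊆case y∈C)) , A⋢H)))

    unique : ∀ N′ → IsComposite L M N′ → N ≈ᴸ N′
    unique N′ (L⊑N′ , N′⊑M) =
        (λ (x∈A , sides) → proj₂ N′≐ (x∈A , λ H b → side-cong {sumOver (subset H) _} ≡.refl (agree H b) (sides H b)))
      , (λ x∈N′ → let x∈A , sides = proj₁ N′≐ x∈N′
                  in x∈A , λ H b → side-cong {sumOver (subset H) _} ≡.refl (≡.sym (agree H b)) (sides H b))
      where
      n′   = proj₁ (Lune.isClosedChamber N′)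
      n′∈A = proj₁ (proj₂ (Lune.isClosedChamber N′))
      n′∉  = proj₁ (proj₂ (proj₂ (Lune.isClosedChamber N′)))
      N′≐  = proj₂ (proj₂ (proj₂ (Lune.isClosedChamber N′)))
      n′∈N′ : region N′ n′
      n′∈N′ = proj₂ N′≐ (n′∈A , λ H _ → square _)
      agree : ∀ H → between A C H → sgn (sumOver (subset H) n₀) ≡ sgn (sumOver (subset H) n′)
      agree H b@(C⊑H , A⋢H) with sumOver (subset H) l ≟ 0#
      ... | no l≉ = ≡.trans (off {H} l≉) (same-side (proj₂ (proj₁ N′≐ (L⊑N′ l∈L)) H b) l≉
                      λ n′≈ → n′∉ H b (flat⊑ambient A n′∈A , n′≈))
        where
        l∈L : region L l
        l∈L = proj₂ L≐ (l∈B , λ H _ → square _)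
      ... | yes l≈ = ≡.trans (sgn-cong (on {H} l≈)) (≡.sym (same-side
                       (proj₂ (proj₁ M≐ (N′⊑M n′∈N′)) H (B⊑ {H} C⊑H l≈ , A⋢H))
                       (λ n′≈ → n′∉ H b (flat⊑ambient A n′∈A , n′≈))
                       λ m≈ → m∉ H (B⊑ {H} C⊑H l≈ , A⋢H) (flat⊑ambient A m∈A , m≈)))

  infixr 9 _∘ᴸ_
  _∘ᴸ_ : ∀ {A B C} → Lune B C → Lune A B → Lune A C
  L ∘ᴸ M = proj₁ (∃!composite L M)

  idLune : ∀ {A B} → space B ≐ space A → Lune A B
  idLune {A} {B} (B⊑A , A⊑B) = record
    { base⊆case = B⊑A
    ; region = λ x → space A x × ∀ H → between A B H → OnSide o H x
    ; isClosedChamber = o , o∈A , (λ H (B⊑H , A⋢H) _ → A⋢H λ x∈ → B⊑H (A⊑B x∈)) , ≐-refl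
    }
    where
    o : Point
    o _ = 0#
    o-sum : ∀ S → sumOver S o ≈ 0#
    o-sum S = sumOver-zero S λ _ → refl
    o∈A : space A o
    o∈A = proj₂ (proj₂ (Flat.isIntersection A)) ((λ S _ → o-sum S) , λ H _ → (λ S _ → o-sum S) , o-sum (subset H))

  data Span {a} (X : Pred Point a) : Pred Point (ℓ ⊔ a) where
    zero : ∀ {x} → (∀ i → x i ≈ 0#) → Span X x
    add  : ∀ {K x y z} → X y → Span X z → (∀ i → x i ≈ combine K y z i) → Span X x

  SameSigns : Point → Pred Point 0ℓ
  SameSigns h x = ∀ (H : Hyperplane) → sgn (sumOver (subset H) x) ≡ sgn (sumOver (subset H) h)

  IsFace : Pred Point ℓ → Set ℓ
  IsFace X = ∃[ h ] ambient h × (X ≐ λ x → ambient x × SameSigns h x)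

  -- An adjoint face with support T∨ P.
  record Face (P : Partition) : Set (lsuc ℓ) where
    field
      region  : Pred Point ℓ
      isFace  : IsFace region
      support : Span region ≐ T∨ P

    point : Point
    point = proj₁ isFace

    -- the sign function of the face; it does not depend on the chosen point
    sign : Subset n → Sgn
    sign S = sgn (sumOver S point)

  open Face using (sign; point)

  infix 4 _≈ᶜ_
  _≈ᶜ_ : ∀ {P} → Face P → Face P → Set ℓ
  X ≈ᶜ Y = Face.region X ≐ Face.region Y

  faceSetoid : Partition → Setoid _ _
  faceSetoid P = record
    { Carrier = Face P
    ; _≈_ = _≈ᶜ_
    ; isEquivalence = record { refl = ≐-refl ; sym = ≐-sym ; trans = ≐-trans }
    }

  data Position (S : Subset n) : Set where
    empty  : (∀ {i} → i ∉ S) → Position S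
    full   : S ≡ ⊤ → Position S
    middle : (H : Hyperplane) → subset H ≡ S → Position S

  position : ∀ S → Position S
  position S with nonempty? S | S ≟ˢ ⊤
  ... | no e  | _     = empty λ i∈ → e (_ , i∈)
  ... | yes _ | yes e = full e
  ... | yes p | no q  = middle (record { subset = S ; nonempty = p ; proper = q }) ≡.refl

  full-zero : ∀ {x} → ambient x → sumOver ⊤ x ≈ 0#
  full-zero x∈ = x∈ ⊤ (fromWitness {a? = ⊤ ≟ˢ ⊤} ≡.refl)

  all-signs : ∀ {x h} → ambient x → ambient h → SameSigns h x → ∀ S → sgn (sumOver S x) ≡ sgn (sumOver S h)
  all-signs x∈ h∈ same S with position S
  ... | empty e = ≡.trans (sgn-zer (sumOver-empty S _ e)) (≡.sym (sgn-zer (sumOver-empty S _ e)))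
  ... | full ≡.refl = ≡.trans (sgn-zer (full-zero x∈)) (≡.sym (sgn-zer (full-zero h∈)))
  ... | middle H ≡.refl = same H

  T∨-cong : ∀ {P x y} → (∀ i → x i ≈ y i) → T∨ P y → T∨ P x
  T∨-cong e y∈ S p = trans (sumOver-cong S e) (y∈ S p)

  span-⊑ : ∀ {a P} {X : Pred Point a} → X ⊑ T∨ P → Span X ⊑ T∨ P
  span-⊑ X⊑ (zero e) S p = sumOver-zero S e
  span-⊑ {P = P} X⊑ (add y z e) = T∨-cong {P} e (T∨-combine {P} (X⊑ y) (span-⊑ {P = P} X⊑ z))

  Generic : Partition → Point → Set ℓ
  Generic P h = T∨ P h × ∀ S → sumOver S h ≈ 0# → Saturated P S

  genericFace : ∀ P h → Generic P h → Face P
  genericFace P h (h∈ , gen) = record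
    { region = X
    ; isFace = h , h∈amb , ≐-refl
    ; support = span-⊑ {P = P} X⊑T , T⊑span
    }
    where
    h∈amb = T∨⊑ambient {P} h∈
    X : Pred Point ℓ
    X x = ambient x × SameSigns h x
    X⊑T : X ⊑ T∨ P
    X⊑T (x∈ , same) S p = zer-sgn (≡.trans (all-signs x∈ h∈amb same S) (sgn-zer (h∈ S p)))
    T⊑span : T∨ P ⊑ Span X
    T⊑span {t} t∈ = add {K = 1#} {y = w} {z = combine (- K) h (λ _ → 0#)}
                      (w∈ , λ H → w-signs (subset H))
                      (add {K = - K} (h∈amb , λ _ → ≡.refl) (zero λ _ → refl) λ _ → refl)
                      eq
      where
      K = proj₁ (perturb (λ S → sumOver S h) (λ S → sumOver S t))
      w = combine K h t
      w∈ : ambient w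
      w∈ = T∨-combine {oneBlock} h∈amb (T∨⊑ambient {P} t∈)
      w-signs : ∀ S → sgn (sumOver S w) ≡ sgn (sumOver S h)
      w-signs S with sumOver S h ≟ 0#
      ... | no h≉  = ≡.trans (sgn-cong (sumOver-combine S K h t))
                       (proj₂ (perturb (λ S → sumOver S h) (λ S → sumOver S t)) S h≉)
      ... | yes h≈ = ≡.trans (sgn-zer (vanish {P} (T∨-combine {P} h∈ t∈) (gen S h≈))) (≡.sym (sgn-zer h≈))
      eq : ∀ i → t i ≈ 1# * (K * h i + t i) + (- K * h i + 0#)
      eq i = sym (begin
        1# * (K * h i + t i) + (- K * h i + 0#)   ≈⟨ +-cong (*-identityˡ _) (+-identityʳ _) ⟩
        (K * h i + t i) + - K * h i               ≈⟨ +-cong (+-comm _ _) (sym (-‿distribˡ-* K (h i))) ⟩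
        (t i + K * h i) + - (K * h i)             ≈⟨ +-assoc _ _ _ ⟩
        t i + (K * h i + - (K * h i))             ≈⟨ +-congˡ (-‿inverseʳ _) ⟩
        t i + 0#                                  ≈⟨ +-identityʳ _ ⟩
        t i                                       ∎)

  module _ {P} (X : Face P) where
    private
      h = point X
      h∈amb = proj₁ (proj₂ (Face.isFace X))
      X≐ = proj₂ (proj₂ (Face.isFace X))

    point-∈ : Face.region X h
    point-∈ = proj₂ X≐ (h∈amb , λ _ → ≡.refl)

    region⊑T∨ : Face.region X ⊑ T∨ P
    region⊑T∨ {x} x∈ = proj₁ (Face.support X) (add {K = 1#} x∈ (zero {x = λ _ → 0#} λ _ → refl)
      λ i → sym (trans (+-identityʳ _) (*-identityˡ _)))

    face-generic : Generic P h
    face-generic = region⊑T∨ point-∈ , λ S h≈ →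
      flat-saturated {P} {S} λ t∈ → zeros S h≈ (proj₂ (Face.support X) t∈)
      where
      zeros : ∀ S → sumOver S h ≈ 0# → ∀ {t} → Span (Face.region X) t → sumOver S t ≈ 0#
      zeros S h≈ (zero e) = sumOver-zero S e
      zeros S h≈ (add {K} {_} {y} {z} y∈ z∈ e) = begin
        sumOver S _                     ≈⟨ sumOver-cong S e ⟩
        sumOver S (combine K y z)       ≈⟨ sumOver-combine S K y z ⟩
        K * sumOver S y + sumOver S z   ≈⟨ +-cong (trans (*-congˡ y≈) (zeroʳ K)) (zeros S h≈ z∈) ⟩
        0# + 0#                         ≈⟨ +-identityˡ 0# ⟩
        0#                              ∎
        where
        y≈ : sumOver S y ≈ 0#
        y≈ = let y∈amb , same = proj₁ X≐ y∈
             in zer-sgn (≡.trans (all-signs y∈amb h∈amb same S) (sgn-zer h≈))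

  record IsDerivative {P Q} (X : Face Q) (V : Cut P Q) (Y : Face P) : Set where
    open Cut V
    field
      on-left  : ∀ {S} → S ≡ left mod P → sign Y S ≡ pos
      on-right : ∀ {S} → S ≡ right mod P → sign Y S ≡ neg
      off-Q    : ∀ {S} → ¬ (S ≡ ⊥ mod Q) → sign Y S ≡ sign X S
      on-P     : ∀ {S} → S ≡ ⊥ mod P → sign Y S ≡ zer

  module CutLemmas {P Q} (V : Cut P Q) where
    open Cut V

    a b : Fin n
    a = proj₁ (Partition.nonempty Q left-block)
    b = proj₁ (Partition.nonempty Q right-block)
    a∈ : a ∈ left
    a∈ = proj₂ (Partition.nonempty Q left-block)
    b∈ : b ∈ right
    b∈ = proj₂ (Partition.nonempty Q right-block)

    apart : ∀ {i} → i ∈ left → i ∉ right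
    apart i∈ i∈′ = left≢right (Partition.disjoint Q left-block right-block i∈ i∈′)

    block-cases : ∀ {B} → B ∈ᵖ P → B ≡ left ∪ right ⊎ B ∈ᵖ Q
    block-cases {B} B∈ with B ≟ˢ left ∪ right
    ... | yes e = inj₁ e
    ... | no ne = inj₂ (other-block B∈ ne)

    e : Point
    e = difference a b

    e∈ : T∨ P e
    e∈ = difference-T∨ {P} whole-block (x∈p∪q⁺ (inj₁ a∈)) (x∈p∪q⁺ (inj₂ b∈))

    saturated-P : ∀ {S} → Saturated Q S → (a ∈ S → right ⊆ S) → (b ∈ S → left ⊆ S) → Saturated P S
    saturated-P {S} sat fa fb B∈ i∈B i∈S {j} j∈B with block-cases B∈
    ... | inj₂ B∈Q = sat B∈Q i∈B i∈S j∈B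
    ... | inj₁ ≡.refl with x∈p∪q⁻ left right i∈B | x∈p∪q⁻ left right j∈B
    ...   | inj₁ iC | inj₁ jC = sat left-block iC i∈S jC
    ...   | inj₁ iC | inj₂ jD = fa (sat left-block iC i∈S a∈) jD
    ...   | inj₂ iD | inj₁ jC = fb (sat right-block iD i∈S b∈) jC
    ...   | inj₂ iD | inj₂ jD = sat right-block iD i∈S jD

    data Relative (S : Subset n) : Set where
      none  : Saturated P S → Relative S
      onlyˡ : a ∈ S → b ∉ S → Relative S
      onlyʳ : a ∉ S → b ∈ S → Relative S

    relative : ∀ {S} → Saturated Q S → Relative S
    relative {S} sat with a ∈? S | b ∈? S
    ... | yes p | yes q = none (saturated-P sat (λ _ → sat right-block b∈ q) (λ _ → sat left-block a∈ p))
    ... | no p  | no q  = none (saturated-P sat (λ a∈S → contradiction a∈S p) (λ b∈S → contradiction b∈S q))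
    ... | yes p | no q  = onlyˡ p q
    ... | no p  | yes q = onlyʳ p q

    P⇒Q : ∀ {S} → Saturated P S → Saturated Q S
    P⇒Q {S} sat {B} {i} B∈ i∈B i∈S {j} j∈B with Partition.cover P i
    ... | B′ , B′∈ , i∈B′ with block-cases B′∈
    ...   | inj₂ B′∈Q with Partition.disjoint Q B∈ B′∈Q i∈B i∈B′
    ...     | ≡.refl = sat B′∈ i∈B i∈S j∈B
    P⇒Q {S} sat {B} {i} B∈ i∈B i∈S {j} j∈B | B′ , B′∈ , i∈B′ | inj₁ ≡.refl with x∈p∪q⁻ left right i∈B′
    ... | inj₁ iC with Partition.disjoint Q B∈ left-block i∈B iC
    ...   | ≡.refl = sat B′∈ i∈B′ i∈S (x∈p∪q⁺ (inj₁ j∈B))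
    P⇒Q {S} sat {B} {i} B∈ i∈B i∈S {j} j∈B | B′ , B′∈ , i∈B′ | inj₁ ≡.refl | inj₂ iD with Partition.disjoint Q B∈ right-block i∈B iD
    ... | ≡.refl = sat B′∈ i∈B′ i∈S (x∈p∪q⁺ (inj₂ j∈B))

    Q⊑P : T∨ Q ⊑ T∨ P
    Q⊑P {h} h∈ S S∈ = vanish {Q} h∈ (P⇒Q λ B∈ i∈B i∈S → λ j∈B →
      ≡.subst (_ ∈_) (Partition.disjoint P B∈ S∈ i∈B i∈S) j∈B)

    whole-zero : ∀ {x} → T∨ P x → sumOver left x + sumOver right x ≈ 0#
    whole-zero {x} x∈ = begin
      sumOver left x + sumOver right x                       ≈⟨ +-congˡ (reflexive (≡.cong (λ E → sumOver E x) eq)) ⟩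
      sumOver left x + sumOver ((left ∪ right) ∩ ∁ left) x   ≈⟨ sumOver-split (left ∪ right) left x (p⊆p∪q right) ⟨
      sumOver (left ∪ right) x                               ≈⟨ x∈ _ whole-block ⟩
      0#                                                     ∎
      where
      eq : right ≡ (left ∪ right) ∩ ∁ left
      eq = ⊆-antisym (λ i∈ → x∈p∩q⁺ (x∈p∪q⁺ (inj₂ i∈) , x∉p⇒x∈∁p λ i∈′ → apart i∈′ i∈))
        λ i∈ → let p , q = x∈p∩q⁻ (left ∪ right) (∁ left) i∈
               in [ (λ z → contradiction z (x∈∁p⇒x∉p q)) , id ]′ (x∈p∪q⁻ left right p)

    drop-left : ∀ {S x} → Saturated Q S → a ∈ S → b ∉ S → T∨ P x → sumOver S x ≈ sumOver left x
    drop-left {S} {x} sat a∈S b∉S x∈ = trans (sumOver-split S left x (sat left-block a∈ a∈S))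
      (trans (+-congˡ (vanish {P} x∈ sat′)) (+-identityʳ _))
      where
      sat′ : Saturated P (S ∩ ∁ left)
      sat′ {B} {i} B∈ i∈B i∈ {j} j∈B with block-cases B∈ | x∈p∩q⁻ S (∁ left) i∈
      ... | inj₂ B∈Q | i∈S , i∉ = x∈p∩q⁺ (sat B∈Q i∈B i∈S j∈B , x∉p⇒x∈∁p λ jC →
              x∈∁p⇒x∉p i∉ (≡.subst (i ∈_) (Partition.disjoint Q B∈Q left-block j∈B jC) i∈B))
      ... | inj₁ ≡.refl | i∈S , i∉ with x∈p∪q⁻ left right i∈B
      ...   | inj₁ iC = contradiction iC (x∈∁p⇒x∉p i∉)
      ...   | inj₂ iD = contradiction (sat right-block iD i∈S b∈) b∉S

  module _ {P Q} (V : Cut P Q) where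
    open Cut V
    private
      module C = CutLemmas V
      module C̄ = CutLemmas (reverse V)

    ∃derivative : ∀ (X : Face Q) → Σ[ Y ∈ Face P ] IsDerivative X V Y
    ∃derivative X = genericFace P y (y∈ , y-gen) , record
      { on-left = λ {S} eq → sgn-value S (trans (sumOver-mod {P} y∈ eq) y-left) sgn-1
      ; on-right = λ {S} eq → sgn-value S (trans (sumOver-mod {P} y∈ eq) y-right) sgn-neg-1
      ; off-Q = λ {S} n → y-off S λ x≈ → n (saturated⇒mod {Q} (x-gen S x≈))
      ; on-P = λ {S} eq → sgn-zer (vanish {P} y∈ (mod⇒saturated {P} eq))
      }
      where
      x = point X
      x∈ = proj₁ (face-generic X)
      x-gen = proj₂ (face-generic X)
      K = proj₁ (perturb (λ S → sumOver S x) (λ S → sumOver S C.e))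
      y = combine K x C.e
      y∈ : T∨ P y
      y∈ = T∨-combine {P} (C.Q⊑P x∈) C.e∈
      sgn-value : ∀ S {v s} → sumOver S y ≈ v → sgn v ≡ s → sgn (sumOver S y) ≡ s
      sgn-value S e e′ = ≡.trans (sgn-cong e) e′
      y-on : ∀ S → sumOver S x ≈ 0# → sumOver S y ≈ sumOver S C.e
      y-on S x≈ = trans (sumOver-combine S K x C.e)
        (trans (+-congʳ (trans (*-congˡ x≈) (zeroʳ K))) (+-identityˡ _))
      y-off : ∀ S → ¬ sumOver S x ≈ 0# → sgn (sumOver S y) ≡ sgn (sumOver S x)
      y-off S x≉ = ≡.trans (sgn-cong (sumOver-combine S K x C.e))
        (proj₂ (perturb (λ S → sumOver S x) (λ S → sumOver S C.e)) S x≉)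
      y-left : sumOver left y ≈ 1#
      y-left = trans (y-on left (x∈ left left-block)) (difference-in C.a∈ λ b∈C → C.apart b∈C C.b∈)
      y-right : sumOver right y ≈ - 1#
      y-right = trans (y-on right (x∈ right right-block)) (difference-out (C.apart C.a∈) C.b∈)
      y-gen : ∀ S → sumOver S y ≈ 0# → Saturated P S
      y-gen S y≈ with sumOver S x ≟ 0#
      ... | no x≉  = contradiction (zer-sgn (≡.trans (≡.sym (y-off S x≉)) (sgn-zer y≈))) x≉
      ... | yes x≈ with C.relative (x-gen S x≈)
      ...   | C.none sat = sat
      ...   | C.onlyˡ p q = contradiction (trans (sym (difference-in p q)) (trans (sym (y-on S x≈)) y≈)) 1≉0
      ...   | C.onlyʳ p q with ≡.trans (≡.sym sgn-neg-1) (sgn-zer (trans (sym (trans (y-on S x≈) (difference-out p q))) y≈))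
      ...     | ()

    halfSpace : Lune (flat P) (flat Q)
    halfSpace = record
      { base⊆case = C.Q⊑P
      ; region = region₀
      ; isClosedChamber = C.e , C.e∈ , e∉ , to , from
      }
      where
      region₀ : Pred Point ℓ
      region₀ h = T∨ P h × 0# ≤ sumOver left h
      satQ : ∀ H → between (flat P) (flat Q) H → Saturated Q (subset H)
      satQ H (Q⊑H , _) = flat-saturated {Q} λ h∈ → proj₂ (Q⊑H h∈)
      ¬satP : ∀ H → between (flat P) (flat Q) H → ¬ Saturated P (subset H)
      ¬satP H (_ , P⋢H) sat = P⋢H λ h∈ → T∨⊑ambient {P} h∈ , vanish {P} h∈ sat
      1-side : ∀ {u v w} → u ≈ w → v ≈ 1# → 0# ≤ w → 0# ≤ u * v
      1-side u≈w v≈1 p l = p (<-respˡ (trans (*-cong u≈w v≈1) (*-identityʳ _)) l)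
      -1-side : ∀ {u v w} → w + u ≈ 0# → v ≈ - 1# → 0# ≤ w → 0# ≤ u * v
      -1-side {u} {v} {w} w+u v≈-1 p l = p (<-respˡ eq l)
        where
        eq : u * v ≈ w
        eq = begin
          u * v            ≈⟨ *-congˡ v≈-1 ⟩
          u * - 1#         ≈⟨ *-comm u (- 1#) ⟩
          - 1# * u         ≈⟨ -1*x≈-x u ⟩
          - u              ≈⟨ +-identityˡ (- u) ⟨
          0# + - u         ≈⟨ +-congʳ (sym w+u) ⟩
          (w + u) + - u    ≈⟨ +-assoc w u (- u) ⟩
          w + (u + - u)    ≈⟨ +-congˡ (-‿inverseʳ u) ⟩
          w + 0#           ≈⟨ +-identityʳ w ⟩
          w                ∎
      e∉ : ∀ H → between (flat P) (flat Q) H → ¬ ⟦ H ⟧ C.e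
      e∉ H b (_ , e≈) with C.relative (satQ H b)
      ... | C.none sat = ¬satP H b sat
      ... | C.onlyˡ p q = 1≉0 (trans (sym (difference-in p q)) e≈)
      ... | C.onlyʳ p q with ≡.trans (≡.sym sgn-neg-1) (sgn-zer (trans (sym (difference-out p q)) e≈))
      ...   | ()
      to : region₀ ⊑ λ x → T∨ P x × ∀ H → between (flat P) (flat Q) H → OnSide C.e H x
      to {x} (x∈ , 0≤) = x∈ , side
        where
        side : ∀ H → between (flat P) (flat Q) H → OnSide C.e H x
        side H b with C.relative (satQ H b)
        ... | C.none sat = ⊥-elim (¬satP H b sat)
        ... | C.onlyˡ p q = 1-side (C.drop-left (satQ H b) p q x∈) (difference-in p q) 0≤
        ... | C.onlyʳ p q = -1-side (trans (+-congˡ (C̄.drop-left (satQ H b) q p x∈)) (C.whole-zero x∈)) (difference-out p q) 0≤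
      from : (λ x → T∨ P x × ∀ H → between (flat P) (flat Q) H → OnSide C.e H x) ⊑ region₀
      from {x} (x∈ , sides) = x∈ , λ l → sides H₀ (Q⊑H₀ , P⋢H₀)
          (<-respˡ (sym (trans (*-congˡ e-left) (*-identityʳ _))) l)
        where
        H₀ : Hyperplane
        H₀ = record { subset = left ; nonempty = C.a , C.a∈
                    ; proper = λ eq → C.apart (≡.subst (C.b ∈_) (≡.sym eq) ∈⊤) C.b∈ }
        e-left : sumOver left C.e ≈ 1#
        e-left = difference-in C.a∈ λ b∈C → C.apart b∈C C.b∈
        Q⊑H₀ : T∨ Q ⊑ ⟦ H₀ ⟧
        Q⊑H₀ h∈ = T∨⊑ambient {Q} h∈ , h∈ left left-block
        P⋢H₀ : ¬ (T∨ P ⊑ ⟦ H₀ ⟧)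
        P⋢H₀ P⊑ = 1≉0 (trans (sym e-left) (proj₂ (P⊑ C.e∈)))

  infixl 10 _^_
  _^_ : ∀ {P Q} → Face Q → Cut P Q → Face P
  X ^ V = proj₁ (∃derivative V X)

  origin : Flat
  origin = flat singletons

  singletons-saturated : ∀ {S} → Saturated singletons S
  singletons-saturated {S} {B} {i} B∈ i∈B i∈S {j} j∈B with toWitness B∈
  ... | k , ≡.refl with x∈⁅y⁆⇒x≡y k i∈B | x∈⁅y⁆⇒x≡y k j∈B
  ...   | ≡.refl | ≡.refl = i∈S

  origin⊑ : ∀ {S h} → T∨ singletons h → sumOver S h ≈ 0#
  origin⊑ {S} h∈ = vanish {singletons} {S} h∈ (singletons-saturated {S})

  module _ {P : Partition} where

    generic-off : ∀ {h} → Generic P h → ∀ H → between (flat P) origin H → ¬ sumOver (subset H) h ≈ 0#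
    generic-off (_ , gen) H (_ , P⋢H) h≈ =
      P⋢H λ t∈ → T∨⊑ambient {P} t∈ , vanish {P} t∈ (gen (subset H) h≈)

    -- any point of a face is an interior point of its closure
    closure : Face P → Lune (flat P) origin
    closure X = record
      { base⊆case = λ h∈ S _ → origin⊑ {S} h∈
      ; region = λ x → T∨ P x × ∀ H → between (flat P) origin H → OnSide h H x
      ; isClosedChamber = h , proj₁ (face-generic X) ,
          (λ H b h∈H → generic-off (face-generic X) H b (proj₂ h∈H)) , ≐-refl
      }
      where
      h = point X

    lune-generic : (M : Lune (flat P) origin) → Generic P (Lune.interior M)
    lune-generic M = m∈ , gen
      where
      m  = proj₁ (Lune.isClosedChamber M)
      m∈ = proj₁ (proj₂ (Lune.isClosedChamber M))
      m∉ = proj₁ (proj₂ (proj₂ (Lune.isClosedChamber M)))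
      gen : ∀ S → sumOver S m ≈ 0# → Saturated P S
      gen S m≈ with position S
      ... | empty e = λ _ _ i∈S → contradiction i∈S e
      ... | full ≡.refl = ⊤-saturated {P}
      ... | middle H ≡.refl = flat-saturated {P} λ h∈ → proj₂ (⊑-stable (flat P) H
              (λ n → m∉ H ((λ h∈ → T∨⊑ambient {singletons} h∈ , origin⊑ {subset H} h∈) , n) (T∨⊑ambient {P} m∈ , m≈)) h∈)

    interior-face : Lune (flat P) origin → Face P
    interior-face M = genericFace P (Lune.interior M) (lune-generic M)

    generic-signs : ∀ {x y} → T∨ P x → T∨ P y →
      (∀ H → between (flat P) origin H → sgn (sumOver (subset H) x) ≡ sgn (sumOver (subset H) y)) → SameSigns y x
    generic-signs {x} {y} x∈ y∈ agree H with sumOver (subset H) x ≟ 0# | sumOver (subset H) y ≟ 0#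
    ... | yes x≈ | yes y≈ = ≡.trans (sgn-zer x≈) (≡.sym (sgn-zer y≈))
    ... | no x≉ | _ = agree H ((λ h∈ → T∨⊑ambient {singletons} h∈ , origin⊑ {subset H} h∈) , λ P⊑ → x≉ (proj₂ (P⊑ x∈)))
    ... | yes _ | no y≉ = agree H ((λ h∈ → T∨⊑ambient {singletons} h∈ , origin⊑ {subset H} h∈) , λ P⊑ → y≉ (proj₂ (P⊑ y∈)))

    closure-cong : ∀ {X Y : Face P} → X ≈ᶜ Y → closure X ≈ᴸ closure Y
    closure-cong {X} {Y} (X⊑Y , _) =
        (λ (x∈ , s) → x∈ , λ H b → side-cong {sumOver (subset H) _} ≡.refl (agree H) (s H b))
      , (λ (x∈ , s) → x∈ , λ H b → side-cong {sumOver (subset H) _} ≡.refl (≡.sym (agree H)) (s H b))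
      where
      agree : SameSigns (point Y) (point X)
      agree = proj₂ (proj₁ (proj₂ (proj₂ (Face.isFace Y))) (X⊑Y (point-∈ X)))

    interior-face-cong : ∀ {M N : Lune (flat P) origin} → M ≈ᴸ N → interior-face M ≈ᶜ interior-face N
    interior-face-cong {M} {N} (M⊑N , _) =
        (λ (x∈ , s) → x∈ , λ H → ≡.trans (s H) (agree H))
      , (λ (x∈ , s) → x∈ , λ H → ≡.trans (s H) (≡.sym (agree H)))
      where
      m∈M : region M (Lune.interior M)
      m∈M = proj₂ (proj₂ (proj₂ (proj₂ (Lune.isClosedChamber M)))) (proj₁ (lune-generic M) , λ _ _ → square _)
      agree : SameSigns (Lune.interior N) (Lune.interior M)
      agree = generic-signs (proj₁ (lune-generic M)) (proj₁ (lune-generic N)) λ H b →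
        same-side (proj₂ (proj₁ (proj₂ (proj₂ (proj₂ (Lune.isClosedChamber N)))) (M⊑N m∈M)) H b)
          (generic-off (lune-generic M) H b) (generic-off (lune-generic N) H b)

    closure-interior : ∀ M → closure (interior-face M) ≈ᴸ M
    closure-interior M = ≐-sym (proj₂ (proj₂ (proj₂ (Lune.isClosedChamber M))))

    interior-closure : ∀ X → interior-face (closure X) ≈ᶜ X
    interior-closure X = ≐-sym (proj₂ (proj₂ (Face.isFace X)))

    identification : Inverse (faceSetoid P) (luneSetoid (flat P) origin)
    identification = record
      { to = closure
      ; from = interior-face
      ; to-cong = λ {X} {Y} → closure-cong {X} {Y}
      ; from-cong = λ {M} {N} → interior-face-cong {M} {N}
      ; inverse = (λ {M} {X} X≈ → ≐-trans (closure-cong {X} {interior-face M} X≈) (closure-interior M))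
                , (λ {X} {M} M≈ → ≐-trans {j = Face.region (interior-face (closure X))} (interior-face-cong {M} {closure X} M≈) (interior-closure X))
      }

module Linear {c ℓ} (𝕜 : Field c ℓ) where
  open Field 𝕜 using (Carrier; 0#; 1#; -_) renaming (_≈_ to _≈ᵏ_; _+_ to _+ᵏ_; _*_ to _*ᵏ_)

  Lin : ∀ {b} → Set b → Set (c ⊔ b)
  Lin B = List (Carrier × B)

  -- The congruence whose quotient is the free vector space on a setoid.
  module _ {b e} (B : Setoid b e) where
    private module B = Setoid B

    data LinEq : Rel (Lin B.Carrier) (c ⊔ ℓ ⊔ b ⊔ e) where
      refl  : ∀ {x} → LinEq x x
      sym   : ∀ {x y} → LinEq x y → LinEq y x
      trans : ∀ {x y z} → LinEq x y → LinEq y z → LinEq x z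
      cons  : ∀ {r s b b′ x y} → r ≈ᵏ s → b B.≈ b′ → LinEq x y → LinEq ((r , b) ∷ x) ((s , b′) ∷ y)
      swap  : ∀ {p q x} → LinEq (p ∷ q ∷ x) (q ∷ p ∷ x)
      merge : ∀ {r s b x} → LinEq ((r , b) ∷ (s , b) ∷ x) ((r +ᵏ s , b) ∷ x)
      drop  : ∀ {b x} → LinEq ((0# , b) ∷ x) x

  η : ∀ {b} {B : Set b} → B → Lin B
  η b = (1# , b) ∷ []

  scale : ∀ {b} {B : Set b} → Carrier → Lin B → Lin B
  scale r = List.map λ (s , b) → r *ᵏ s , b

  infixl 6 _⊖_
  _⊖_ : ∀ {b} {B : Set b} → Lin B → Lin B → Lin B
  x ⊖ y = x ++ scale (- 1#) y

  -- the linear map with the given values on the basis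
  extend : ∀ {a b} {A : Set a} {B : Set b} → (A → Lin B) → Lin A → Lin B
  extend f = List.concatMap λ (r , a) → scale r (f a)

  linMap : ∀ {a b} {A : Set a} {B : Set b} → (A → B) → Lin A → Lin B
  linMap f = extend (η ∘ f)

module Functors {c ℓ r} (𝕜 : Field c ℓ) (R : OrderedField r) (n : ℕ) .{{_ : NonZero n}} where
  open Field 𝕜 using (1#; -_; semiring)
  open Exp semiring using () renaming (_^_ to _^ᵏ_)
  open Linear 𝕜
  open Partitions n
  open Arrangement R n
  open Lunes R n

  L∨ : Partition → Set (c ⊔ lsuc r)
  L∨ P = Lin (Face P)

  infix 4 _≈ᵛ_
  _≈ᵛ_ : ∀ {P} → Rel (L∨ P) (c ⊔ ℓ ⊔ lsuc r)
  _≈ᵛ_ {P} = LinEq (faceSetoid P)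

  -- Lay Q P is the space of morphisms Q → P
  Lay : Partition → Partition → Set c
  Lay Q P = Lin (Forest P Q)

  Ass∨ : Flat → Flat → Set (c ⊔ lsuc r)
  Ass∨ A B = Lin (Lune A B)

  infixr 9 _∘̂_
  _∘̂_ : ∀ {A B C} → Ass∨ B C → Ass∨ A B → Ass∨ A C
  y ∘̂ x = extend (λ L → extend (λ M → η (L ∘ᴸ M)) x) y

  -- π is contravariant: V₁ ∘ … ∘ V_l goes to π(V_l) ∘ … ∘ π(V₁).
  π-cuts : ∀ {P Q} → Cuts P Q → Lune (flat P) (flat Q)
  π-cuts {P} {Q} ([] P≐Q) = idLune (T∨-≐ {P} {Q} P≐Q)
  π-cuts (V ∷ Vs) = π-cuts Vs ∘ᴸ halfSpace V

  π : ∀ {P Q} → Lay Q P → Ass∨ (flat P) (flat Q)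
  π = linMap λ F → π-cuts (proj₁ (factorisation F))

  -- the sign is the parity of the number of switched nodes
  𝒜 : ∀ {P Q} → Lay Q P → Lay Q P
  𝒜 = extend λ F → List.map (λ ε → (- 1#) ^ᵏ ∣ ε ∣ , switch F ε) (allSubsets (Forest.size F))

  -- the contravariant functor represented by the flat 0
  Hom₀ : ∀ {A B} → Ass∨ A B → Ass∨ B origin → Ass∨ A origin
  Hom₀ φ x = x ∘̂ φ

  -- Hom₀ under the identification of L∨ P with Ass∨ (flat P) origin
  onFaces : ∀ {P Q} → Ass∨ (flat P) (flat Q) → L∨ Q → L∨ P
  onFaces φ v = linMap (Inverse.from identification) (Hom₀ φ (linMap (Inverse.to identification) v))

  transport : ∀ {P Q} → P ≐ᵖ Q → Face Q → Face P
  transport {P} {Q} P≐Q X = record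
    { region = Face.region X ; isFace = Face.isFace X
    ; support = ≐-trans (Face.support X) (T∨-≐ {P} {Q} P≐Q)
    }

  infixl 10 _^ᶜ_ _^ᶠ_
  _^ᶜ_ : ∀ {P Q} → Face Q → Cuts P Q → Face P
  X ^ᶜ [] P≐Q   = transport P≐Q X
  X ^ᶜ (V ∷ Vs) = (X ^ᶜ Vs) ^ V

  _^ᶠ_ : ∀ {P Q} → Face Q → Forest P Q → Face P
  X ^ᶠ F = X ^ᶜ proj₁ (factorisation F)

  ∂*-cut : ∀ {P Q} → Cut P Q → L∨ Q → L∨ P
  ∂*-cut V = extend λ X → η (X ^ V) ⊖ η (X ^ reverse V)

  ∂*-cuts : ∀ {P Q} → Cuts P Q → L∨ Q → L∨ P
  ∂*-cuts ([] P≐Q) v = linMap (transport P≐Q) v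
  ∂*-cuts (V ∷ Vs) v = ∂*-cut V (∂*-cuts Vs v)

  ∂* : ∀ {P Q} → Forest P Q → L∨ Q → L∨ P
  ∂* F = ∂*-cuts (proj₁ (factorisation F))

{-# OPTIONS --safe #-}
module Submission where

-- X^V and X ∘ π(V) are cut out by the same point: a point of X, perturbed in the
-- direction of the half-space of V.  On signs, composition of lunes is the Tits product,
-- hence associative, so the action of π on faces is the iterated derivative.  For
-- the antisymmetrised functor, the cuts of a switched forest are the cuts of the forest,
-- some of them reversed: the first cut is read off the node with label 0, which makes the
-- factorisation of a forest unique.  The alternating sum over the switches is then the
-- expansion of the composite of the differences X^V − X^V̄.

open import Defs
import Algebra.Properties.Semiring.Exp as Exp
open import Data.Bool.Base using (Bool; true; false; if_then_else_)
open import Data.Empty using (⊥-elim)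
open import Data.Fin.Subset using (Subset; _∪_; inside; outside; ∣_∣)
open import Data.Fin.Subset.Properties using (∪-comm; x∈p∪q⁻)
open import Data.List.Base as List using (List; []; _∷_; _++_)
open import Data.List.Properties using (map-++; map-∘; ++-assoc; ++-identityʳ)
open import Data.Nat.Base using (ℕ; zero; suc; pred; NonZero)
open import Data.Product.Base using (Σ-syntax; _×_; _,_; proj₁; proj₂)
open import Data.Sum.Base using (inj₁; inj₂)
open import Data.Vec.Base using ([]; _∷_)
open import Function.Base using (_∘_)
open import Function.Bundles using (Inverse)
open import Relation.Binary.Bundles using (Setoid)
open import Relation.Binary.Core using (Rel)
open import Relation.Binary.PropositionalEquality as ≡ using (_≡_; _≢_; refl; cong; cong₂; subst)
import Relation.Binary.Reasoning.Setoid as SetoidReasoning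
open import Relation.Nullary using (¬_; contradiction; Dec; yes; no)
open import Relation.Unary using (_≐_)
open import Relation.Unary.Properties using (≐-refl; ≐-sym; ≐-trans)

-- Alternating sums indexed by subsets.

module SignedSums {c ℓ} (𝕜 : Field c ℓ) (n : ℕ) where
  open Linear 𝕜 using (Lin; _⊖_)
  open Field 𝕜 using (Carrier; 1#; -_; semiring)
  open Exp semiring using () renaming (_^_ to _^ᵏ_)
  open Partitions n using (allSubsets)
  open ≡ using (sym; trans)

  sign : ∀ {m} → Subset m → Carrier
  sign ε = (- 1#) ^ᵏ ∣ ε ∣

  signed : ∀ {b} {B : Set b} m → (Subset m → B) → Lin B
  signed m f = List.map (λ ε → sign ε , f ε) (allSubsets m)

  -- `allSubsets` lists the subsets avoiding the first element before those containing it, and each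
  -- of the latter carries one more factor `- 1#`.
  signed-suc : ∀ {b} {B : Set b} m (f : Subset (suc m) → B) →
    signed (suc m) f ≡ signed m (f ∘ (outside ∷_)) ⊖ signed m (f ∘ (inside ∷_))
  signed-suc m f = trans (map-++ _ (List.map (outside ∷_) ms) (List.map (inside ∷_) ms))
    (cong₂ _++_ (sym (map-∘ ms)) (trans (sym (map-∘ ms)) (map-∘ ms)))
    where
    ms = allSubsets m

-- Linear extension of maps between free vector spaces, and its effect on alternating sums.

module LinearProperties {c ℓ b e} (𝕜 : Field c ℓ) (n : ℕ) (B : Setoid b e) where
  open Linear 𝕜
  private
    module K = Field 𝕜
    module B = Setoid B
    variable
      x x′ y y′ : Lin B.Carrier
  open Partitions n using (allSubsets)
  open SignedSums 𝕜 n

  infix 4 _≋_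
  _≋_ : Rel (Lin B.Carrier) _
  _≋_ = LinEq B

  ≋-setoid : Setoid _ _
  ≋-setoid = record
    { Carrier = Lin B.Carrier
    ; _≈_ = _≋_
    ; isEquivalence = record { refl = refl ; sym = sym ; trans = trans }
    }

  open SetoidReasoning ≋-setoid

  ≋-reflexive : x ≡ y → x ≋ y
  ≋-reflexive refl = refl

  ++-congˡ : ∀ x → y ≋ y′ → x ++ y ≋ x ++ y′
  ++-congˡ []      eq = eq
  ++-congˡ (p ∷ x) eq = cons K.refl B.refl (++-congˡ x eq)

  shift : ∀ p x y → x ++ p ∷ y ≋ p ∷ x ++ y
  shift p []      y = refl
  shift p (q ∷ x) y = trans (cons K.refl B.refl (shift p x y)) swap

  ++-comm : ∀ x y → x ++ y ≋ y ++ x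
  ++-comm []      y = ≋-reflexive (≡.sym (++-identityʳ y))
  ++-comm (p ∷ x) y = trans (cons K.refl B.refl (++-comm x y)) (sym (shift p y x))

  ++-cong : x ≋ x′ → y ≋ y′ → x ++ y ≋ x′ ++ y′
  ++-cong {x} {x′} {y} {y′} eq eq′ = begin
    x ++ y    ≈⟨ ++-comm x y ⟩
    y ++ x    ≈⟨ ++-congˡ y eq ⟩
    y ++ x′   ≈⟨ ++-comm y x′ ⟩
    x′ ++ y   ≈⟨ ++-congˡ x′ eq′ ⟩
    x′ ++ y′  ∎

  scale-congʳ : ∀ r → x ≋ y → scale r x ≋ scale r y
  scale-congʳ r refl = refl
  scale-congʳ r (sym p) = sym (scale-congʳ r p)
  scale-congʳ r (trans p q) = trans (scale-congʳ r p) (scale-congʳ r q)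
  scale-congʳ r (cons s≈ b≈ p) = cons (K.*-congˡ s≈) b≈ (scale-congʳ r p)
  scale-congʳ r swap = swap
  scale-congʳ r merge = trans merge (cons (K.sym (K.distribˡ r _ _)) B.refl refl)
  scale-congʳ r drop = trans (cons (K.zeroʳ r) B.refl refl) drop

  scale-congˡ : ∀ {r s} x → r K.≈ s → scale r x ≋ scale s x
  scale-congˡ []      eq = refl
  scale-congˡ (_ ∷ x) eq = cons (K.*-congʳ eq) B.refl (scale-congˡ x eq)

  scale-* : ∀ r s x → scale r (scale s x) ≋ scale (r K.* s) x
  scale-* r s []            = refl
  scale-* r s ((t , b) ∷ x) = cons (K.sym (K.*-assoc r s t)) B.refl (scale-* r s x)

  scale-1 : ∀ x → scale K.1# x ≋ x
  scale-1 []      = refl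
  scale-1 (_ ∷ x) = cons (K.*-identityˡ _) B.refl (scale-1 x)

  scale-0 : ∀ x → scale K.0# x ≋ []
  scale-0 []      = refl
  scale-0 (_ ∷ x) = trans (cons (K.zeroˡ _) B.refl (scale-0 x)) drop

  scale-+ : ∀ r s x → scale r x ++ scale s x ≋ scale (r K.+ s) x
  scale-+ r s []            = refl
  scale-+ r s ((t , b) ∷ x) = begin
    (r K.* t , b) ∷ scale r x ++ (s K.* t , b) ∷ scale s x    ≈⟨ cons K.refl B.refl (shift _ (scale r x) (scale s x)) ⟩
    (r K.* t , b) ∷ (s K.* t , b) ∷ scale r x ++ scale s x    ≈⟨ merge ⟩
    (r K.* t K.+ s K.* t , b) ∷ scale r x ++ scale s x        ≈⟨ cons (K.sym (K.distribʳ t r s)) B.refl (scale-+ r s x) ⟩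
    ((r K.+ s) K.* t , b) ∷ scale (r K.+ s) x                 ∎

  extend-≗ : ∀ {a} {A : Set a} {f g : A → Lin B.Carrier} → (∀ a → f a ≋ g a) → ∀ u → extend f u ≋ extend g u
  extend-≗ eq []            = refl
  extend-≗ eq ((r , a) ∷ u) = ++-cong (scale-congʳ r (eq a)) (extend-≗ eq u)

  module _ {a} {A : Set a} where

    extend-++ : ∀ (f : A → Lin B.Carrier) u v → extend f (u ++ v) ≡ extend f u ++ extend f v
    extend-++ f []            v = refl
    extend-++ f ((r , a) ∷ u) v = ≡.trans (cong (scale r (f a) ++_) (extend-++ f u v))
      (≡.sym (++-assoc (scale r (f a)) (extend f u) (extend f v)))

    extend-scale : ∀ (f : A → Lin B.Carrier) r u → extend f (scale r u) ≋ scale r (extend f u)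
    extend-scale f r []            = refl
    extend-scale f r ((s , a) ∷ u) = begin
      scale (r K.* s) (f a) ++ extend f (scale r u)    ≈⟨ ++-cong (sym (scale-* r s (f a))) (extend-scale f r u) ⟩
      scale r (scale s (f a)) ++ scale r (extend f u)  ≡⟨ map-++ _ (scale s (f a)) (extend f u) ⟨
      scale r (scale s (f a) ++ extend f u)            ∎

    extend-η : ∀ (f : A → Lin B.Carrier) a → extend f (η a) ≋ f a
    extend-η f a = trans (≋-reflexive (++-identityʳ _)) (scale-1 (f a))

    extend-∘ : ∀ {a′} {A′ : Set a′} (g : A → Lin B.Carrier) (f : A′ → Lin A) u →
      extend g (extend f u) ≋ extend (extend g ∘ f) u
    extend-∘ g f []            = refl
    extend-∘ g f ((r , a) ∷ u) = begin
      extend g (scale r (f a) ++ extend f u)             ≡⟨ extend-++ g (scale r (f a)) (extend f u) ⟩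
      extend g (scale r (f a)) ++ extend g (extend f u)  ≈⟨ ++-cong (extend-scale g r (f a)) (extend-∘ g f u) ⟩
      scale r (extend g (f a)) ++ extend (extend g ∘ f) u ∎

    extend-linMap : ∀ {a′} {A′ : Set a′} (g : A → Lin B.Carrier) (f : A′ → A) u →
      extend g (linMap f u) ≋ extend (g ∘ f) u
    extend-linMap g f u = trans (extend-∘ g (η ∘ f) u) (extend-≗ (extend-η g ∘ f) u)

  linMap-map : ∀ {a i} {A : Set a} {I : Set i} (s : I → K.Carrier) (f : I → A) {g : A → B.Carrier} {h : I → B.Carrier} →
    (∀ i → g (f i) B.≈ h i) → ∀ is → linMap g (List.map (λ i → s i , f i) is) ≋ List.map (λ i → s i , h i) is
  linMap-map s f eq []       = refl
  linMap-map s f eq (i ∷ is) = cons (K.*-identityʳ (s i)) (eq i) (linMap-map s f eq is)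

  -- The shape of onFaces ∘ π, for arbitrary maps in place of the operations on lunes.
  linMap-bilinear : ∀ {a a₁ a₂ a₃ a₄} {A : Set a} {A₁ : Set a₁} {A₂ : Set a₂} {A₃ : Set a₃} {A₄ : Set a₄}
    (k : A₄ → B.Carrier) (_∙_ : A₁ → A₂ → A₄) (c : A → A₁) (p : A₃ → A₂) (u : Lin A₃) (v : Lin A) →
    linMap k (extend (λ l → linMap (l ∙_) (linMap p u)) (linMap c v)) ≋
    extend (λ a → linMap (λ x → k (c a ∙ p x)) u) v
  linMap-bilinear k _∙_ c p u v = begin
    linMap k (extend after (linMap c v))              ≈⟨ extend-∘ (η ∘ k) after (linMap c v) ⟩
    extend (linMap k ∘ after) (linMap c v)            ≈⟨ extend-linMap (linMap k ∘ after) c v ⟩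
    extend (linMap k ∘ after ∘ c) v                   ≈⟨ extend-≗ (λ a → extend-linMap (η ∘ k) (c a ∙_) (linMap p u)) v ⟩
    extend (λ a → linMap (k ∘ (c a ∙_)) (linMap p u)) v
                                                      ≈⟨ extend-≗ (λ a → extend-linMap (η ∘ k ∘ (c a ∙_)) p u) v ⟩
    extend (λ a → linMap (λ x → k (c a ∙ p x)) u) v   ∎
    where
    after = λ l → linMap (l ∙_) (linMap p u)

  extend-linMap-η : ∀ {a a′} {A : Set a} {A′ : Set a′} (h : A → A′ → B.Carrier) x {g : A → B.Carrier} →
    (∀ a → h a x B.≈ g a) → ∀ v → extend (λ a → linMap (h a) (η x)) v ≋ linMap g v
  extend-linMap-η h x eq = extend-≗ λ a → trans (extend-η (η ∘ h a) x) (cons K.refl (eq a) refl)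

  extend-linMap-extend-η : ∀ {a a′ a″} {A : Set a} {A′ : Set a′} {A″ : Set a″}
    (h : A → A′ → B.Carrier) (f : A″ → Lin A′) x v →
    extend (λ a → linMap (h a) (extend f (η x))) v ≋ extend (λ a → linMap (h a) (f x)) v
  extend-linMap-extend-η h f x = extend-≗ λ a →
    trans (extend-∘ (η ∘ h a) f (η x)) (extend-η (linMap (h a) ∘ f) x)

  -- Each generator of `LinEq` is respected: `swap` by commutativity of `++`, `merge` by `scale-+`,
  -- `drop` by `scale-0`. This allows a linear map to be applied to an inductive hypothesis that
  -- holds up to `LinEq`.
  extend-cong : ∀ {a ℓ′} (A : Setoid a ℓ′) {f : Setoid.Carrier A → Lin B.Carrier} →
    (∀ {a a′} → Setoid._≈_ A a a′ → f a ≋ f a′) → ∀ {u v} → LinEq A u v → extend f u ≋ extend f v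
  extend-cong A f-cong refl = refl
  extend-cong A f-cong (sym p) = sym (extend-cong A f-cong p)
  extend-cong A f-cong (trans p q) = trans (extend-cong A f-cong p) (extend-cong A f-cong q)
  extend-cong A f-cong (cons r≈ a≈ p) =
    ++-cong (trans (scale-congʳ _ (f-cong a≈)) (scale-congˡ _ r≈)) (extend-cong A f-cong p)
  extend-cong A {f} f-cong (swap {r , a} {s , a′} {u}) = begin
    scale r (f a) ++ scale s (f a′) ++ extend f u      ≡⟨ ++-assoc (scale r (f a)) _ _ ⟨
    (scale r (f a) ++ scale s (f a′)) ++ extend f u    ≈⟨ ++-cong (++-comm (scale r (f a)) _) refl ⟩
    (scale s (f a′) ++ scale r (f a)) ++ extend f u    ≡⟨ ++-assoc (scale s (f a′)) _ _ ⟩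
    scale s (f a′) ++ scale r (f a) ++ extend f u      ∎
  extend-cong A {f} f-cong (merge {r} {s} {a} {u}) = begin
    scale r (f a) ++ scale s (f a) ++ extend f u       ≡⟨ ++-assoc (scale r (f a)) _ _ ⟨
    (scale r (f a) ++ scale s (f a)) ++ extend f u     ≈⟨ ++-cong (scale-+ r s (f a)) refl ⟩
    scale (r K.+ s) (f a) ++ extend f u                ∎
  extend-cong A {f} f-cong (drop {a} {u}) = ++-cong (scale-0 (f a)) refl

  extend-⊖ : ∀ {a} {A : Set a} (f g : A → Lin B.Carrier) u →
    extend (λ a → f a ⊖ g a) u ≋ extend f u ⊖ extend g u
  extend-⊖ f g []            = refl
  extend-⊖ f g ((r , a) ∷ u) = begin
    scale r (f a ⊖ g a) ++ extend (λ a → f a ⊖ g a) u      ≈⟨ ++-cong (trans (≋-reflexive (map-++ _ (f a) _)) (++-congˡ (scale r (f a)) commute)) (extend-⊖ f g u) ⟩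
    (X ++ - Y) ++ (U ++ - W)                               ≡⟨ ++-assoc X (- Y) _ ⟩
    X ++ - Y ++ U ++ - W                                   ≡⟨ cong (X ++_) (++-assoc (- Y) U _) ⟨
    X ++ (- Y ++ U) ++ - W                                 ≈⟨ ++-congˡ X (++-cong (++-comm (- Y) U) refl) ⟩
    X ++ (U ++ - Y) ++ - W                                 ≡⟨ cong (X ++_) (++-assoc U (- Y) _) ⟩
    X ++ U ++ - Y ++ - W                                   ≡⟨ ++-assoc X U _ ⟨
    (X ++ U) ++ - Y ++ - W                                 ≡⟨ cong ((X ++ U) ++_) (map-++ _ Y W) ⟨
    (X ++ U) ⊖ (Y ++ W)                                    ∎
    where
    -_ : Lin B.Carrier → Lin B.Carrier
    -_ = scale (K.- K.1#)
    X = scale r (f a)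
    Y = scale r (g a)
    U = extend f u
    W = extend g u
    commute : scale r (- g a) ≋ - Y
    commute = begin
      scale r (- g a)                 ≈⟨ scale-* r _ (g a) ⟩
      scale (r K.* (K.- K.1#)) (g a)  ≈⟨ scale-congˡ (g a) (K.*-comm r _) ⟩
      scale ((K.- K.1#) K.* r) (g a)  ≈⟨ scale-* _ r (g a) ⟨
      - Y                             ∎

  -- This is `signed-suc` read backwards: `f` supplies the terms avoiding the first element, `g`
  -- those containing it, with the extra sign.
  extend-⊖-signed : ∀ {a m} {A : Set a} (f g : A → B.Carrier) (h : Subset m → A) (w : Subset (suc m) → B.Carrier) →
    (∀ ε → f (h ε) B.≈ w (outside ∷ ε)) → (∀ ε → g (h ε) B.≈ w (inside ∷ ε)) →
    extend (λ a → η (f a) ⊖ η (g a)) (signed m h) ≋ signed (suc m) w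
  extend-⊖-signed {m = m} f g h w eq eq′ = begin
    extend (λ a → η (f a) ⊖ η (g a)) (signed m h)                    ≈⟨ extend-⊖ (η ∘ f) (η ∘ g) (signed m h) ⟩
    linMap f (signed m h) ⊖ linMap g (signed m h)                    ≈⟨ ++-cong (linMap-map sign h eq ms) (scale-congʳ _ (linMap-map sign h eq′ ms)) ⟩
    signed m (w ∘ (outside ∷_)) ⊖ signed m (w ∘ (inside ∷_))         ≡⟨ signed-suc m w ⟨
    signed (suc m) w                                                 ∎
    where
    ms = allSubsets m

  -- The inductive step of `∂*-cuts-signed` for abstract maps: `f` and `g` stand for the derivatives
  -- along a cut and its reverse, `h` for the faces obtained from the switched remaining cuts, `w`
  -- for those obtained from all cuts.
  extend-signed-suc : ∀ {a a′ ℓ′ m} (A : Setoid a ℓ′) {A′ : Set a′} {f g : Setoid.Carrier A → B.Carrier} →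
    (∀ {x y} → Setoid._≈_ A x y → f x B.≈ f y) → (∀ {x y} → Setoid._≈_ A x y → g x B.≈ g y) →
    (h : A′ → Subset m → Setoid.Carrier A) (w : A′ → Subset (suc m) → B.Carrier) →
    (∀ a ε → f (h a ε) B.≈ w a (outside ∷ ε)) → (∀ a ε → g (h a ε) B.≈ w a (inside ∷ ε)) →
    ∀ v {u} → LinEq A (extend (signed m ∘ h) v) u →
    extend (signed (suc m) ∘ w) v ≋ extend (λ x → η (f x) ⊖ η (g x)) u
  extend-signed-suc {m = m} A {f = f} {g} f-cong g-cong h w eq eq′ v {u} v≈u = begin
    extend (signed (suc m) ∘ w) v             ≈⟨ extend-≗ (λ a → extend-⊖-signed f g (h a) (w a) (eq a) (eq′ a)) v ⟨
    extend (extend f⊖g ∘ signed m ∘ h) v      ≈⟨ extend-∘ f⊖g (signed m ∘ h) v ⟨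
    extend f⊖g (extend (signed m ∘ h) v)      ≈⟨ extend-cong A f⊖g-cong v≈u ⟩
    extend f⊖g u                              ∎
    where
    f⊖g = λ x → η (f x) ⊖ η (g x)
    f⊖g-cong : ∀ {x y} → Setoid._≈_ A x y → f⊖g x ≋ f⊖g y
    f⊖g-cong x≈y = cons K.refl (f-cong x≈y) (cons K.refl (g-cong x≈y) refl)

-- Uniqueness of the factorisation into cuts, and the cuts of a switched forest.

module CutsProperties (n : ℕ) where
  open Partitions n
  open ≡ using (sym; trans)

  private
    variable
      P P′ Q R R′ : Partition

  relabel-suc-injective : ∀ {S} {t u : Tree Q S} → relabel suc t ≡ relabel suc u → t ≡ u
  relabel-suc-injective {t = t} {u} eq = trans (sym (undo t)) (trans (cong (relabel pred) eq) (undo u))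
    where
    undo : ∀ {S} (t : Tree Q S) → relabel pred (relabel suc t) ≡ t
    undo t = trans (relabel-∘ pred suc t) (relabel-id _ t λ _ → refl)

  node-injective : ∀ {S C D C′ D′ k k′} .{p : S splits-into C , D} .{p′ : S splits-into C′ , D′}
    {t : Tree Q C} {u : Tree Q D} {t′ : Tree Q C′} {u′ : Tree Q D′} →
    node k p t u ≡ node k′ p′ t′ u′ →
    Σ[ c ∈ C ≡ C′ ] Σ[ d ∈ D ≡ D′ ] subst (Tree Q) c t ≡ t′ × subst (Tree Q) d u ≡ u′
  node-injective refl = refl , refl , refl , refl

  -- Distinguishes the block split by the first cut of a composite from all other blocks, whose
  -- trees are shifted by one.
  node-0≢relabel-suc : ∀ {S C D} .{p : S splits-into C , D} {t : Tree Q C} {u : Tree Q D} (v : Tree Q S) →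
    node 0 p t u ≢ relabel suc v
  node-0≢relabel-suc (leaf _) ()
  node-0≢relabel-suc (node _ _ _ _) ()

  module _ (V : Cut P R) (Vs : Cuts R Q) where
    open Cut V
    open Forest (composite (V ∷ Vs)) using () renaming (tree to whole-tree)
    open Forest (composite Vs) using (tree)

    -- The tree of a composite over `S` is stuck on the test `S ≟ˢ left ∪ right`; this lemma and the
    -- next evaluate it in the two cases.
    tree-whole : ∀ S (p : S ∈ᵖ P) (eq : S ≡ left ∪ right) →
      whole-tree S p ≡ node 0 (subst (_splits-into left , right) (sym eq) (cut-splits V))
        (relabel suc (tree left left-block)) (relabel suc (tree right right-block))
    tree-whole S p eq with S ≟ˢ left ∪ right
    ... | yes _ = refl
    ... | no ne = contradiction eq ne

    tree-other : ∀ S (p : S ∈ᵖ P) (ne : S ≢ left ∪ right) →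
      whole-tree S p ≡ relabel suc (tree S (other-block p ne))
    tree-other S p ne with S ≟ˢ left ∪ right
    ... | yes eq = contradiction eq ne
    ... | no _   = refl

  data CutBlock (V : Cut P R) (E : Subset n) : Set where
    isLeft  : E ≡ Cut.left V → CutBlock V E
    isRight : E ≡ Cut.right V → CutBlock V E
    isOther : E ∈ᵖ P → E ≢ Cut.left V ∪ Cut.right V → CutBlock V E

  -- The fields of `Cut` put these blocks into `R`; there are no others because they already cover
  -- the set. A point of `E` lies in some block of `P`, hence in one of them, and blocks of `R` that
  -- meet are equal.
  cutBlock : ∀ (V : Cut P R) E → E ∈ᵖ R → CutBlock V E
  cutBlock {P} {R} V E q with Partition.nonempty R q
  ... | i , i∈E with Partition.cover P i
  ...   | B , p , i∈B with B ≟ˢ Cut.left V ∪ Cut.right V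
  ...     | no ne with Partition.disjoint R q (Cut.other-block V p ne) i∈E i∈B
  ...       | refl = isOther p ne
  cutBlock {P} {R} V E q | i , i∈E | B , p , i∈B | yes refl with x∈p∪q⁻ _ _ i∈B
  ... | inj₁ i∈l = isLeft (Partition.disjoint R q (Cut.left-block V) i∈E i∈l)
  ... | inj₂ i∈r = isRight (Partition.disjoint R q (Cut.right-block V) i∈E i∈r)

  cut-⊆ : (V : Cut P R) (W : Cut P′ R′) → (∀ {S} → S ∈ᵖ P → S ∈ᵖ P′) →
    Cut.left V ≡ Cut.left W → Cut.right V ≡ Cut.right W → ∀ {S} → S ∈ᵖ R → S ∈ᵖ R′
  cut-⊆ {R′ = R′} V W P⊆P′ eq eq′ q with cutBlock V _ q
  ... | isLeft refl  = subst (_∈ᵖ R′) (sym eq) (Cut.left-block W)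
  ... | isRight refl = subst (_∈ᵖ R′) (sym eq′) (Cut.right-block W)
  ... | isOther p ne = Cut.other-block W (P⊆P′ p) λ e → ne (trans e (sym (cong₂ _∪_ eq eq′)))

  -- `_≈ᶠ_` compares forests over one and the same partition, but the partitions left after removing
  -- first cuts are known to agree up to `≐ᵖ`.
  SameTrees : Forest P Q → Forest P′ Q → Set
  SameTrees {P} {Q} {P′} F G = ∀ S (p : S ∈ᵖ P) (p′ : S ∈ᵖ P′) → Forest.tree F S p ≡ Forest.tree G S p′

  -- Over the block that `W` cuts, one forest has a leaf and the other a node.
  ¬SameTrees-cut-id : ∀ {P≐Q : P ≐ᵖ Q} (W : Cut P′ R) (Ws : Cuts R Q) → P ≐ᵖ P′ →
    ¬ SameTrees {P} {Q} (composite ([] P≐Q)) (composite (W ∷ Ws))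
  ¬SameTrees-cut-id W Ws (_ , P′⊆P) same
    with trans (same _ (P′⊆P (Cut.whole-block W)) (Cut.whole-block W)) (tree-whole W Ws _ (Cut.whole-block W) refl)
  ... | ()

  module _ (V : Cut P R) (Vs : Cuts R Q) (W : Cut P′ R′) (Ws : Cuts R′ Q) (P≐P′ : P ≐ᵖ P′)
           (same : SameTrees (composite (V ∷ Vs)) (composite (W ∷ Ws))) where
    private
      module V = Cut V
      module W = Cut W
      module F = Forest (composite Vs)
      module G = Forest (composite Ws)

    -- The tree over the block cut by `V` has root label 0. If `W` cut another block, the second
    -- forest would have a shifted tree there, with no root 0. So both cut the same block, and the
    -- two parts are read off the common root.
    first-cut : Σ[ l ∈ V.left ≡ W.left ] Σ[ r ∈ V.right ≡ W.right ]
      subst (Tree Q) l (relabel suc (F.tree V.left V.left-block)) ≡ relabel suc (G.tree W.left W.left-block) ×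
      subst (Tree Q) r (relabel suc (F.tree V.right V.right-block)) ≡ relabel suc (G.tree W.right W.right-block)
    first-cut with V.left ∪ V.right ≟ˢ W.left ∪ W.right
    ... | yes eq = node-injective (trans (sym (tree-whole V Vs _ V.whole-block refl))
            (trans (same _ V.whole-block (proj₁ P≐P′ V.whole-block)) (tree-whole W Ws _ (proj₁ P≐P′ V.whole-block) eq)))
    ... | no ne = contradiction (trans (sym (tree-whole V Vs _ V.whole-block refl))
            (trans (same _ V.whole-block (proj₁ P≐P′ V.whole-block)) (tree-other W Ws _ (proj₁ P≐P′ V.whole-block) ne)))
            (node-0≢relabel-suc _)

    same-left : V.left ≡ W.left
    same-left = proj₁ first-cut

    same-right : V.right ≡ W.right
    same-right = proj₁ (proj₂ first-cut)

    same-middle : R ≐ᵖ R′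
    same-middle = cut-⊆ V W (proj₁ P≐P′) same-left same-right
                , cut-⊆ W V (proj₂ P≐P′) (sym same-left) (sym same-right)

    private
      along : ∀ {C C′} {t : Tree Q C} .{c′ : C′ ∈ᵖ R′} .{c : C ∈ᵖ R′} (eq : C ≡ C′) →
        subst (Tree Q) eq t ≡ relabel suc (G.tree C′ c′) → t ≡ relabel suc (G.tree C c)
      along refl e = e

    same-rest : SameTrees (composite Vs) (composite Ws)
    same-rest E q q′ with cutBlock V E q
    ... | isLeft refl  = relabel-suc-injective (along same-left (proj₁ (proj₂ (proj₂ first-cut))))
    ... | isRight refl = relabel-suc-injective (along same-right (proj₂ (proj₂ (proj₂ first-cut))))
    ... | isOther p ne = relabel-suc-injective (trans (sym (tree-other V Vs E p ne))
            (trans (same E p (proj₁ P≐P′ p)) (tree-other W Ws _ (proj₁ P≐P′ p)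
              λ e → ne (trans e (sym (cong₂ _∪_ same-left same-right))))))

  -- The k-th cut, counted from 0, becomes the node with label k of the composite. A function on all
  -- of `ℕ` shifts to `ε ∘ suc` for the remaining cuts.
  switchCuts : (ℕ → Bool) → Cuts P Q → Cuts P Q
  switchCuts ε ([] P≐Q) = [] P≐Q
  switchCuts ε (V ∷ Vs) = (if ε 0 then reverse V else V) ∷ switchCuts (ε ∘ suc) Vs

  switch-relabel : ∀ {S} ε (t : Tree Q S) → switchTree ε (relabel suc t) ≡ relabel suc (switchTree (ε ∘ suc) t)
  switch-relabel ε (leaf _) = refl
  switch-relabel ε (node k p t u) with ε (suc k)
  ... | true  = cong₂ (node (suc k) _) (switch-relabel ε u) (switch-relabel ε t)
  ... | false = cong₂ (node (suc k) _) (switch-relabel ε t) (switch-relabel ε u)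

  -- Reversing the first cut exchanges the two subtrees at the node 0; the nodes with larger labels
  -- are handled by induction.
  tree-switchCuts : ∀ ε (Vs : Cuts P Q) S (p : S ∈ᵖ P) →
    Forest.tree (composite (switchCuts ε Vs)) S p ≡ switchTree ε (Forest.tree (composite Vs) S p)
  tree-switchCuts ε ([] _) S p = refl
  tree-switchCuts {P} {Q} ε (_∷_ {R = R} V Vs) S p = by-cases (S ≟ˢ left ∪ right)
    where
    open Cut V
    rest : ∀ E (q : E ∈ᵖ R) → relabel suc (Forest.tree (composite (switchCuts (ε ∘ suc) Vs)) E q)
      ≡ switchTree ε (relabel suc (Forest.tree (composite Vs) E q))
    rest E q = trans (cong (relabel suc) (tree-switchCuts (ε ∘ suc) Vs E q)) (sym (switch-relabel ε (Forest.tree (composite Vs) E q)))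
    by-cases : Dec (S ≡ left ∪ right) →
      Forest.tree (composite (switchCuts ε (V ∷ Vs))) S p ≡ switchTree ε (Forest.tree (composite (V ∷ Vs)) S p)
    by-cases (yes eq) rewrite tree-whole V Vs S p eq with ε 0
    -- The reversed cut splits the block written as `right ∪ left`.
    ... | true  = trans (tree-whole (reverse V) (switchCuts (ε ∘ suc) Vs) S p (trans eq (∪-comm left right)))
                        (cong₂ (node 0 _) (rest right right-block) (rest left left-block))
    ... | false = trans (tree-whole V (switchCuts (ε ∘ suc) Vs) S p eq)
                        (cong₂ (node 0 _) (rest left left-block) (rest right right-block))
    by-cases (no ne) rewrite tree-other V Vs S p ne with ε 0
    ... | true  = trans (tree-other (reverse V) (switchCuts (ε ∘ suc) Vs) S p λ e → ne (trans e (∪-comm right left)))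
                        (rest S (other-block p ne))
    ... | false = trans (tree-other V (switchCuts (ε ∘ suc) Vs) S p ne) (rest S (other-block p ne))

-- Composition of lunes, computed on the signs of interior points.

module LuneProperties {ℓ} (R : OrderedField ℓ) (n : ℕ) .{{_ : NonZero n}} where
  open OrderedField R hiding (zero; refl; sym; trans)
  private module F = OrderedField R
  open Signs R
  open Partitions n
  open Arrangement R n
  open Lunes R n
  open Hyperplane using (subset)
  open Lune using (region; interior)
  open ≡ using (sym; trans)
  open CutsProperties n

  private
    variable
      A A′ B B′ C D : Flat
      P Q : Partition

  -- the Tits product of signs
  infixr 7 _▹_
  _▹_ : Sgn → Sgn → Sgn
  zer ▹ t = t
  pos ▹ t = pos
  neg ▹ t = neg

  ▹-assoc : ∀ s t u → (s ▹ t) ▹ u ≡ s ▹ (t ▹ u)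
  ▹-assoc pos t u = refl
  ▹-assoc neg t u = refl
  ▹-assoc zer t u = refl

  ▹-nonzero : ∀ {s t} → s ≢ zer → s ▹ t ≡ s
  ▹-nonzero {pos} _ = refl
  ▹-nonzero {neg} _ = refl
  ▹-nonzero {zer} n = contradiction refl n

  interior-sign : Lune A B → Subset n → Sgn
  interior-sign M S = sgn (sumOver S (interior M))

  -- The interior point of the composite is `K` times that of `L` plus that of `M`, for large `K`:
  -- the first decides the sign wherever it is nonzero, and otherwise leaves it to the second.
  ∘ᴸ-sign : ∀ (L : Lune B C) (M : Lune A B) S →
    interior-sign (L ∘ᴸ M) S ≡ interior-sign L S ▹ interior-sign M S
  ∘ᴸ-sign L M S = trans (sgn-cong (sumOver-combine S K l m)) by-cases
    where
    l = interior L
    m = interior M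
    -- The same `K` as in `∃!composite`, so that the interior point of `L ∘ᴸ M` computes to
    -- `combine K l m`.
    K = proj₁ (perturb (λ S → sumOver S l) (λ S → sumOver S m))
    by-cases : sgn (K * sumOver S l + sumOver S m) ≡ sgn (sumOver S l) ▹ sgn (sumOver S m)
    by-cases with sumOver S l ≟ 0#
    ... | yes l≈ = trans
            (sgn-cong (F.trans (+-congʳ (F.trans (*-congˡ l≈) (zeroʳ K))) (+-identityˡ _)))
            (cong (_▹ sgn (sumOver S m)) (sym (sgn-zer l≈)))
    ... | no l≉ = trans
            (proj₂ (perturb (λ S → sumOver S l) (λ S → sumOver S m)) S l≉)
            (sym (▹-nonzero (l≉ ∘ zer-sgn)))

  -- A lune is the intersection, within its case, of the half-spaces containing its interior point,
  -- and these depend on the signs of that point alone.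
  same-interior-sign : (M N : Lune A B) → (∀ S → interior-sign M S ≡ interior-sign N S) → M ≈ᴸ N
  same-interior-sign M N eq = ⊑ M N eq , ⊑ N M (sym ∘ eq)
    where
    ⊑ : ∀ (M N : Lune A B) → (∀ S → interior-sign M S ≡ interior-sign N S) → ∀ {x} → region M x → region N x
    ⊑ M N eq {x} x∈M with Lune.isClosedChamber M | Lune.isClosedChamber N | eq
    ... | _ , _ , _ , M⊑ , _ | _ , _ , _ , _ , ⊑N | eq = let x∈A , sides = M⊑ x∈M in
      ⊑N (x∈A , λ H b → side-cong {sumOver (subset H) x} refl (eq (subset H)) (sides H b))

  ∘ᴸ-assoc : ∀ (L : Lune C D) (M : Lune B C) (N : Lune A B) → (L ∘ᴸ M) ∘ᴸ N ≈ᴸ L ∘ᴸ (M ∘ᴸ N)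
  ∘ᴸ-assoc L M N = same-interior-sign ((L ∘ᴸ M) ∘ᴸ N) (L ∘ᴸ (M ∘ᴸ N)) λ S → begin
    interior-sign ((L ∘ᴸ M) ∘ᴸ N) S                              ≡⟨ ∘ᴸ-sign (L ∘ᴸ M) N S ⟩
    interior-sign (L ∘ᴸ M) S ▹ interior-sign N S                 ≡⟨ cong (_▹ interior-sign N S) (∘ᴸ-sign L M S) ⟩
    (interior-sign L S ▹ interior-sign M S) ▹ interior-sign N S  ≡⟨ ▹-assoc (interior-sign L S) _ _ ⟩
    interior-sign L S ▹ interior-sign M S ▹ interior-sign N S    ≡⟨ cong (interior-sign L S ▹_) (∘ᴸ-sign M N S) ⟨
    interior-sign L S ▹ interior-sign (M ∘ᴸ N) S                 ≡⟨ ∘ᴸ-sign L (M ∘ᴸ N) S ⟨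
    interior-sign (L ∘ᴸ (M ∘ᴸ N)) S                              ∎
    where open ≡.≡-Reasoning

  -- Partitions with the same blocks give flats with the same points that are still different as
  -- records; this moves a lune between them.
  recase : space A ≐ space A′ → Lune A B → Lune A′ B
  recase {A} {A′} {B} (A⊑A′ , A′⊑A) M = record
    { base⊆case = A⊑A′ ∘ Lune.base⊆case M
    ; region = region M
    ; isClosedChamber =
        let h , h∈ , h∉ , to , from = Lune.isClosedChamber M in
        h , A⊑A′ h∈ , (λ H b → h∉ H (b-to H b))
          , (λ x∈ → let x∈A , sides = to x∈ in A⊑A′ x∈A , λ H b → sides H (b-to H b))
          , (λ (x∈ , sides) → from (A′⊑A x∈ , λ H b → sides H (b-from H b)))
    }
    where
    b-to : ∀ H → between A′ B H → between A B H
    b-to H (B⊑H , A′⋢H) = B⊑H , λ A⊑H → A′⋢H λ x∈ → A⊑H (A′⊑A x∈)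
    b-from : ∀ H → between A B H → between A′ B H
    b-from H (B⊑H , A⋢H) = B⊑H , λ A′⊑H → A⋢H λ x∈ → A′⊑H (A⊑A′ x∈)

  -- After a change of case, `L′ ∘ᴸ M′` also lies between the regions of `L` and `M`, so it is their
  -- composite by uniqueness.
  ∘ᴸ-cong : (L : Lune B C) (M : Lune A B) (L′ : Lune B′ C) (M′ : Lune A′ B′) → space A′ ≐ space A →
    region L ≐ region L′ → region M ≐ region M′ → region (L ∘ᴸ M) ≐ region (L′ ∘ᴸ M′)
  ∘ᴸ-cong L M L′ M′ A′≐A L≐L′ M≐M′ = proj₂ (proj₂ (∃!composite L M)) (recase A′≐A (L′ ∘ᴸ M′))
    ( (λ x∈ → proj₁ L′⊑M′ (proj₁ L≐L′ x∈))
    , (λ x∈ → proj₂ M≐M′ (proj₂ L′⊑M′ x∈)) )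
    where
    L′⊑M′ : IsComposite L′ M′ (L′ ∘ᴸ M′)
    L′⊑M′ = proj₁ (proj₂ (∃!composite L′ M′))

  -- The derivative and the composite of lunes are both built by perturbing a point of X
  -- in the direction of the half-space, so both sides have the same interior point.
  closure-^ : (X : Face Q) (V : Cut P Q) → closure (X ^ V) ≈ᴸ closure X ∘ᴸ halfSpace V
  closure-^ X V = ≐-refl

  -- Equal faces may carry different chosen points, from which the derivatives are built. The
  -- comparison therefore passes to closures, where the derivative is a composite of lunes and
  -- `∘ᴸ-cong` applies.
  ^-cong : {X Y : Face Q} (V : Cut P Q) → X ≈ᶜ Y → X ^ V ≈ᶜ Y ^ V
  ^-cong {X = X} {Y} V X≈Y = ≐-trans {j = Face.region (interior-face (closure (X ^ V)))}
    (≐-sym (interior-closure (X ^ V)))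
    (≐-trans {j = Face.region (interior-face (closure (Y ^ V)))}
      (interior-face-cong {M = closure (X ^ V)} {closure (Y ^ V)}
        (∘ᴸ-cong (closure X) (halfSpace V) (closure Y) (halfSpace V) ≐-refl (closure-cong {X = X} {Y} X≈Y) ≐-refl))
      (interior-closure (Y ^ V)))

  -- No hyperplane contains the base without containing the case, so the side conditions are vacuous
  -- and both regions are the whole flat.
  idLune-≐ : {A≐B : space B ≐ space A} {A′≐B : space B ≐ space A′} →
    region (idLune {A} {B} A≐B) ≐ region (idLune {A′} {B} A′≐B)
  idLune-≐ {A = A} {A′ = A′} {A≐B} {A′≐B} =
      (λ (x∈ , _) → proj₁ A′≐B (proj₂ A≐B x∈) , λ H (B⊑H , A⋢H) → ⊥-elim (A⋢H λ y∈ → B⊑H (proj₂ A′≐B y∈)))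
    , (λ (x∈ , _) → proj₁ A≐B (proj₂ A′≐B x∈) , λ H (B⊑H , A⋢H) → ⊥-elim (A⋢H λ y∈ → B⊑H (proj₂ A≐B y∈)))

-- The action of forests on faces, plain and antisymmetrised.

module FunctorProperties {c ℓ r} (𝕜 : Field c ℓ) (R : OrderedField r) (n : ℕ) .{{_ : NonZero n}} where
  open Partitions n
  open Arrangement R n
  open Lunes R n
  open Linear 𝕜 using (η; extend; linMap)
  open Functors 𝕜 R n
  open Lune using (region)
  open CutsProperties n
  open LuneProperties R n
  open SignedSums 𝕜 n
  open ≡ using (sym; trans)

  private
    variable
      P P′ Q : Partition
    module Faces (P : Partition) = LinearProperties 𝕜 n (faceSetoid P)

  -- The transported face keeps its point, so its closure is that of `X` with the case changed; this
  -- lies inside the identity lune, which is the whole flat, and uniqueness of composites applies.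
  closure-transport : (P≐Q : P ≐ᵖ Q) (X : Face Q) →
    closure (transport {P} {Q} P≐Q X) ≈ᴸ closure X ∘ᴸ π-cuts {P} {Q} ([] P≐Q)
  closure-transport {P} {Q} P≐Q X = ≐-trans
    (same-interior-sign (closure (transport {P} {Q} P≐Q X)) (recase TQ≐TP (closure X)) λ _ → refl)
    (≐-sym (proj₂ (proj₂ (∃!composite (closure X) (π-cuts {P} {Q} ([] P≐Q)))) (recase TQ≐TP (closure X))
      ( (λ x∈ → x∈)
      , λ (x∈ , _) → proj₁ TQ≐TP x∈ , λ H (Q⊑H , P⋢H) → ⊥-elim (P⋢H λ y∈ → Q⊑H (proj₂ TQ≐TP y∈)) )))
    where
    TQ≐TP : T∨ Q ≐ T∨ P
    TQ≐TP = T∨-≐ {P} {Q} P≐Q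

  closure-^ᶜ : (X : Face Q) (Vs : Cuts P Q) → closure (X ^ᶜ Vs) ≈ᴸ closure X ∘ᴸ π-cuts Vs
  closure-^ᶜ {Q} {P} X ([] P≐Q) = closure-transport {P} {Q} P≐Q X
  closure-^ᶜ X (V ∷ Vs) = ≐-trans
    -- By computation, as in `closure-^`, the left side is already a composite with `halfSpace V`.
    (∘ᴸ-cong (closure (X ^ᶜ Vs)) (halfSpace V) (closure X ∘ᴸ π-cuts Vs) (halfSpace V) ≐-refl (closure-^ᶜ X Vs) ≐-refl)
    (∘ᴸ-assoc (closure X) (π-cuts Vs) (halfSpace V))

  -- Uniqueness of the factorisation, expressed on lunes. A nonempty sequence of cuts never has the
  -- trees of an empty one; two nonempty ones share their first cut, and the remaining cuts again
  -- have the same trees.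
  π-cuts-cong : (Vs : Cuts P Q) (Ws : Cuts P′ Q) → P ≐ᵖ P′ → SameTrees (composite Vs) (composite Ws) →
    region (π-cuts Vs) ≐ region (π-cuts Ws)
  π-cuts-cong {P} {Q} {P′} ([] P≐Q) ([] P′≐Q) _ _ =
    idLune-≐ {B = flat Q} {A = flat P} {flat P′} {T∨-≐ {P} {Q} P≐Q} {T∨-≐ {P′} {Q} P′≐Q}
  π-cuts-cong {P} {Q} ([] P≐Q) (W ∷ Ws) P≐P′ same = contradiction same (¬SameTrees-cut-id {P} {Q} {P≐Q = P≐Q} W Ws P≐P′)
  π-cuts-cong {Q = Q} {P′} (V ∷ Vs) ([] P′≐Q) (P⊆P′ , P′⊆P) same =
    contradiction (λ S p p′ → sym (same S p′ p)) (¬SameTrees-cut-id {P′} {Q} {P≐Q = P′≐Q} V Vs (P′⊆P , P⊆P′))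
  π-cuts-cong {P} {P′ = P′} (V ∷ Vs) (W ∷ Ws) P≐P′ same =
    ∘ᴸ-cong (π-cuts Vs) (halfSpace V) (π-cuts Ws) (halfSpace W) TP′≐TP
      (π-cuts-cong Vs Ws (same-middle V Vs W Ws P≐P′ same) (same-rest V Vs W Ws P≐P′ same))
      half
    where
    TP′≐TP : T∨ P′ ≐ T∨ P
    TP′≐TP = T∨-≐ {P} {P′} P≐P′
    half : region (halfSpace V) ≐ region (halfSpace W)
    half rewrite same-left V Vs W Ws P≐P′ same =
        (λ (x∈ , 0≤) → proj₂ TP′≐TP x∈ , 0≤) , (λ (x∈ , 0≤) → proj₁ TP′≐TP x∈ , 0≤)

  cuts : Forest P Q → Cuts P Q
  cuts F = proj₁ (factorisation F)

  tree-cuts : (F : Forest P Q) → ∀ S (p : S ∈ᵖ P) → Forest.tree (composite (cuts F)) S p ≡ Forest.tree F S p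
  tree-cuts F = _≈ᶠ_.tree-≡ (proj₂ (factorisation F))

  -- The factorisation chosen for the switched forest need not be literally the switched
  -- factorisation of `F`, but their composites have the same trees.
  π-cuts-switch : (F : Forest P Q) (ε : Subset (Forest.size F)) →
    π-cuts (cuts (switch F ε)) ≈ᴸ π-cuts (switchCuts (layer ε) (cuts F))
  π-cuts-switch {P} F ε = π-cuts-cong (cuts (switch F ε)) (switchCuts (layer ε) (cuts F)) (≐ᵖ-refl {P}) λ S p _ →
    trans (tree-cuts (switch F ε) S p)
      (trans (cong (switchTree (layer ε)) (sym (tree-cuts F S p)))
             (sym (tree-switchCuts (layer ε) (cuts F) S p)))

  interior-face-∘ : (X : Face Q) (M : Lune (flat P) (flat Q)) (Vs : Cuts P Q) → M ≈ᴸ π-cuts Vs →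
    interior-face (closure X ∘ᴸ M) ≈ᶜ X ^ᶜ Vs
  interior-face-∘ X M Vs M≈ = ≐-trans {j = Face.region (interior-face (closure (X ^ᶜ Vs)))}
    (interior-face-cong {M = closure X ∘ᴸ M} {closure (X ^ᶜ Vs)}
      (≐-trans (∘ᴸ-cong (closure X) M (closure X) (π-cuts Vs) ≐-refl ≐-refl M≈) (≐-sym (closure-^ᶜ X Vs))))
    (interior-closure (X ^ᶜ Vs))

  act : Face Q → Forest P Q → Face P
  act X F = Inverse.from identification (Inverse.to identification X ∘ᴸ π-cuts (cuts F))

  onFaces-π : (u : Lay Q P) (v : L∨ Q) → onFaces (π u) v ≈ᵛ extend (λ X → linMap (act X) u) v
  onFaces-π {P = P} = linMap-bilinear (Inverse.from identification) _∘ᴸ_ (Inverse.to identification) (λ F → π-cuts (cuts F))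
    where open Faces P

  onFaces-forest : (F : Forest P Q) (v : L∨ Q) → onFaces (π (η F)) v ≈ᵛ linMap (_^ᶠ F) v
  onFaces-forest {P} F v = Linear.trans (onFaces-π (η F) v)
    (extend-linMap-η act F (λ X → interior-face-∘ X (π-cuts (cuts F)) (cuts F) ≐-refl) v)
    where open Faces P

  -- Each term of the alternating sum acts as a single forest, and `π-cuts-switch` replaces its cuts
  -- by those of `F`, some of them reversed.
  onFaces-𝒜 : (F : Forest P Q) (v : L∨ Q) →
    onFaces (π (𝒜 (η F))) v ≈ᵛ
    extend (λ X → signed (Forest.size F) λ ε → X ^ᶜ switchCuts (layer ε) (cuts F)) v
  onFaces-𝒜 {P} F v = Linear.trans (onFaces-π (𝒜 (η F)) v) (Linear.trans
    (extend-linMap-extend-η act (λ G → signed (Forest.size G) (switch G)) F v)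
    (extend-≗ (λ X → linMap-map sign (switch F) (pointwise X) (allSubsets (Forest.size F))) v))
    where
    open Faces P
    pointwise : ∀ X ε → act X (switch F ε) ≈ᶜ X ^ᶜ switchCuts (layer ε) (cuts F)
    pointwise X ε = interior-face-∘ X (π-cuts (cuts (switch F ε))) (switchCuts (layer ε) (cuts F)) (π-cuts-switch F ε)

  -- Induction on the cuts: the outermost difference doubles the alternating sum for the remaining
  -- cuts, the first entry of `ε` choosing between `V` and `reverse V`.
  ∂*-cuts-signed : ∀ (Vs : Cuts P Q) {m} → m ≡ Forest.size (composite Vs) → (v : L∨ Q) →
    extend (λ X → signed m λ ε → X ^ᶜ switchCuts (layer ε) Vs) v ≈ᵛ ∂*-cuts Vs v
  -- `signed 0` is a single term with coefficient `1#`, that is, an `η`, so both sides coincide by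
  -- computation.
  ∂*-cuts-signed ([] _) refl v = Linear.refl
  ∂*-cuts-signed {P} {Q} (_∷_ {R = R₁} V Vs) refl v = extend-signed-suc (faceSetoid R₁)
    (λ {X} {Y} → ^-cong {X = X} {Y} V) (λ {X} {Y} → ^-cong {X = X} {Y} (reverse V))
    (λ X ε → X ^ᶜ switchCuts (layer ε) Vs) (λ X ε → X ^ᶜ switchCuts (layer ε) (V ∷ Vs))
    (λ _ _ → ≐-refl) (λ _ _ → ≐-refl) v (∂*-cuts-signed Vs refl v)
    where open Faces P

mainTheorem7 :
  ∀ {c ℓ r} (𝕜 : Field c ℓ) → CharacteristicZero 𝕜 →
  (R : OrderedField r) (n : ℕ) .{{_ : NonZero n}} →
  let open Partitions n
      open Arrangement R n
      open Lunes R n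
      open Linear 𝕜
      open Functors 𝕜 R n
  in
  (∀ {P Q} (X : Face Q) (V : Cut P Q) →
    Inverse.to identification (X ^ V) ≈ᴸ Inverse.to identification X ∘ᴸ halfSpace V)
  × (∀ {P Q} (F : Forest P Q) (v : L∨ Q) →
    onFaces (π (η F)) v ≈ᵛ linMap (_^ᶠ F) v)
  × (∀ {P Q} (F : Forest P Q) (v : L∨ Q) →
    onFaces (π (𝒜 (η F))) v ≈ᵛ ∂* F v)
mainTheorem7 𝕜 _ R n = closure-^ , onFaces-forest , λ F v →
  -- Switches are indexed by the size of `F`, while the induction runs over its factorisation;
  -- `size-≡` reconciles the two.
  Linear.trans (onFaces-𝒜 F v) (∂*-cuts-signed (cuts F) (≡.sym (size-≡ F)) v)
  where
  open LuneProperties R n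
  open FunctorProperties 𝕜 R n
  open Partitions n
  size-≡ : ∀ {P Q} (F : Forest P Q) → Forest.size (composite (cuts F)) ≡ Forest.size F
  size-≡ F = _≈ᶠ_.size-≡ (proj₂ (factorisation F))
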